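{- Let $I_n$ be the number of inversion sequences $(a_1,\dots,a_n)$ for which there are no indices $i<j<k$ with $a_i\ne a_j$, $a_j\ne a_k$ and $a_i\ge a_k$ (equivalently, avoiding the patterns $010,101,120,201,210$), with $I_0=1$. Let \[ X_1=\frac{2+z-\sqrt5\,z-\sqrt{ -2(\sqrt5-3)z^2-4(\sqrt5+3)z+4}}{4z},\qquad X_3=\frac{2+z+\sqrt5\,z-\sqrt{2(\sqrt5+3)z^2+4(\sqrt5-3)z+4}}{4z}, \] which are formal power series in $z$ with $X_1=1+\tfrac12(1+\sqrt5)z+(2+\sqrt5)z^2+\cdots$ and $X_3=1+\tfrac12(1-\sqrt5)z+(2-\sqrt5)z^2+\cdots$. Then \[ \sum_{n\ge0} I_n z^n=-\frac{X_1z+X_3z-1}{X_1X_3z^2-X_1z-X_3z-z+1}=1+z+2z^2+5z^3+15z^4+51z^5+188z^6+733z^7+\cdots. \]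
   Context: An inversion sequence of length $n$ is an integer sequence $(a_1,\dots,a_n)$ with $0\le a_i<i$ for all $i$. A pattern is a sequence of non-negative integers containing every value from $0$ to its maximum; a sequence contains a pattern $\sigma$ of length $k$ if some subsequence $a_{i_1}\cdots a_{i_k}$ ($i_1<\dots<i_k$) has the same relative order (including equalities) as $\sigma$, and avoids it otherwise. The empty sequence is the unique inversion sequence of length $0$. -}

module Defs where

open import Data.Nat as ℕ using (ℕ; zero; suc; _∸_; _<_)
open import Data.Integer using (+_)
open import Data.Rational as Q using (ℚ; 0ℚ; 1ℚ)
open import Data.List as L using (List; []; _∷_; _++_; length; upTo; concatMap; filter)
open import Data.Vec as V using (Vec; lookup; _∷ʳ_)
open import Data.Fin as F using (Fin; toℕ)
open import Data.Fin.Properties using (any?)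
open import Data.Product using (Σ; _×_; _,_)
open import Data.Nat.Properties using (_≟_; _<?_; _≤?_)
open import Relation.Nullary using (¬_; Dec; ¬?; _×-dec_)
open import Data.Maybe using (fromMaybe)

-- All inversion sequences of length n, as vectors (a_1,…,a_n) with
-- 0 ≤ a_i < i (1-based).  Index i (0-based in Fin n) holds a value < toℕ i + 1.
invSeqs : (n : ℕ) → List (Vec ℕ n)
invSeqs zero    = V.[] ∷ []
invSeqs (suc n) = concatMap (λ v → L.map (λ x → v ∷ʳ x) (upTo (suc n))) (invSeqs n)

Bad : ∀ {n} → Vec ℕ n → Set
Bad {n} a = Σ (Fin n) λ i → Σ (Fin n) λ j → Σ (Fin n) λ k →
  (toℕ i < toℕ j) × (toℕ j < toℕ k) ×
  (¬ (lookup a i ≡' lookup a j)) × (¬ (lookup a j ≡' lookup a k)) ×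
  (lookup a k ℕ.≤ lookup a i)
  where open import Relation.Binary.PropositionalEquality renaming (_≡_ to _≡'_)

bad? : ∀ {n} (a : Vec ℕ n) → Dec (Bad a)
bad? a = any? λ i → any? λ j → any? λ k →
  (toℕ i <? toℕ j) ×-dec (toℕ j <? toℕ k) ×-dec
  ¬? (lookup a i ≟ lookup a j) ×-dec ¬? (lookup a j ≟ lookup a k) ×-dec
  (lookup a k ≤? lookup a i)

Avoids : ∀ {n} → Vec ℕ n → Set
Avoids a = ¬ Bad a

avoids? : ∀ {n} (a : Vec ℕ n) → Dec (Avoids a)
avoids? a = ¬? (bad? a)

I : ℕ → ℕ
I n = length (filter avoids? (invSeqs n))

record Q5 : Set where
  constructor _+√5·_
  field
    re : ℚ
    ir : ℚ
open Q5 public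

infixl 6 _⊕_
infixl 7 _⊗_

_⊕_ : Q5 → Q5 → Q5
(a +√5· b) ⊕ (c +√5· d) = (a Q.+ c) +√5· (b Q.+ d)

_⊗_ : Q5 → Q5 → Q5
(a +√5· b) ⊗ (c +√5· d) =
  ((a Q.* c) Q.+ ((+ 5 Q./ 1) Q.* (b Q.* d))) +√5· ((a Q.* d) Q.+ (b Q.* c))

⊖_ : Q5 → Q5
⊖ (a +√5· b) = (Q.- a) +√5· (Q.- b)

_⊝_ : Q5 → Q5 → Q5
x ⊝ y = x ⊕ (⊖ y)

rat : ℚ → Q5
rat q = q +√5· 0ℚ

nat : ℕ → Q5
nat n = rat (+ n Q./ 1)

𝟘 𝟙 √5 : Q5
𝟘 = rat 0ℚ
𝟙 = rat 1ℚ
√5 = 0ℚ +√5· 1ℚ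

PS : Set
PS = ℕ → Q5

sumTo : ℕ → (ℕ → Q5) → Q5
sumTo zero    f = 𝟘
sumTo (suc n) f = sumTo n f ⊕ f n

infixl 6 _+ₚ_ _-ₚ_
infixl 7 _*ₚ_

_+ₚ_ : PS → PS → PS
(f +ₚ g) n = f n ⊕ g n

-ₚ_ : PS → PS
(-ₚ f) n = ⊖ f n

_-ₚ_ : PS → PS → PS
f -ₚ g = f +ₚ (-ₚ g)

_*ₚ_ : PS → PS → PS
(f *ₚ g) n = sumTo (suc n) λ i → f i ⊗ g (n ∸ i)

cst : Q5 → PS
cst c zero    = c
cst c (suc n) = 𝟘

Z : PS
Z (suc zero) = 𝟙
Z _          = 𝟘

poly : List Q5 → PS
poly cs n = fromMaybe 𝟘 (L.head (L.drop n cs))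

GF : PS
GF n = nat (I n)

private
  nth : List Q5 → ℕ → Q5
  nth cs n = fromMaybe 𝟘 (L.head (L.drop n cs))

-- Square root of a power series D with constant term 4: the unique series S
-- with S 0 = 2 and S * S = D, i.e.
--   S_n = (D_n - Σ_{i=1}^{n-1} S_i S_{n-i}) / 4   for n ≥ 1.
sqrtCoeffs : PS → ℕ → List Q5
sqrtCoeffs D zero    = nat 2 ∷ []
sqrtCoeffs D (suc n) =
  let s = sqrtCoeffs D n
      new = (D (suc n) ⊝ sumTo n (λ i → nth s (suc i) ⊗ nth s (n ∸ i)))
              ⊗ rat (+ 1 Q./ 4)
  in s ++ (new ∷ [])

sqrt4 : PS → PS
sqrt4 D n = nth (sqrtCoeffs D n) n

-- Multiplicative inverse of a power series A with constant term 1: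
--   C_0 = 1,  C_n = - Σ_{i=1}^{n} A_i C_{n-i}.
invCoeffs : PS → ℕ → List Q5
invCoeffs A zero    = 𝟙 ∷ []
invCoeffs A (suc n) =
  let c = invCoeffs A n
      new = ⊖ sumTo (suc n) (λ i → A (suc i) ⊗ nth c (n ∸ i))
  in c ++ (new ∷ [])

inv1 : PS → PS
inv1 A n = nth (invCoeffs A n) n

-- Division by z of a series with zero constant term
divZ : PS → PS
divZ f n = f (suc n)

scale : Q5 → PS → PS
scale c f n = c ⊗ f n

D₁ : PS
D₁ = poly (nat 4 ∷ (⊖ (nat 4 ⊗ (√5 ⊕ nat 3))) ∷ (⊖ (nat 2 ⊗ (√5 ⊝ nat 3))) ∷ [])

D₃ : PS
D₃ = poly (nat 4 ∷ (nat 4 ⊗ (√5 ⊝ nat 3)) ∷ (nat 2 ⊗ (√5 ⊕ nat 3)) ∷ [])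

B₁ B₃ : PS
B₁ = poly (nat 2 ∷ (𝟙 ⊝ √5) ∷ [])
B₃ = poly (nat 2 ∷ (𝟙 ⊕ √5) ∷ [])

X₁ X₃ : PS
X₁ = scale (rat (+ 1 Q./ 4)) (divZ (B₁ -ₚ sqrt4 D₁))
X₃ = scale (rat (+ 1 Q./ 4)) (divZ (B₃ -ₚ sqrt4 D₃))

Num Den : PS
Num = (X₁ *ₚ Z) +ₚ (X₃ *ₚ Z) -ₚ cst 𝟙
Den = (X₁ *ₚ X₃ *ₚ Z *ₚ Z) -ₚ (X₁ *ₚ Z) -ₚ (X₃ *ₚ Z) -ₚ Z +ₚ cst 𝟙

-- An avoiding sequence may be continued by x exactly when x repeats its last entry ℓ or
-- x ≥ q, where q exceeds by one the largest entry before the last run (q = 0 if none).  The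
-- number of continuations of a state depends only on the length of its allowed range and,
-- linearly, on ℓ − q; writing A v + u B v for its generating function in t, this becomes a
-- first-order linear recurrence in v for A, B and their partial sums S, T.  The transfer
-- matrix has left eigenvectors with eigenvalue 1/X for X = X₁, X₃, so the corresponding
-- linear form E satisfies E v = t X E (v + 1), hence has infinite order, hence vanishes.
-- The two linear relations between A 0 and B 0 obtained at v = 0 determine A 0, and
-- Σ Iₙ tⁿ = 1 + t A 0.

module Submission where

open import Defs

-- Appending one entry to an avoiding sequence.

module Counting where

  open import Data.Empty using (⊥-elim)
  open import Data.Fin.Base using (Fin; zero; suc; toℕ; fromℕ; inject₁)
  open import Data.Fin.Properties using (toℕ-inject₁; toℕ-fromℕ; toℕ<n)
  open import Data.Fin.Relation.Unary.Top using (view; ‵fromℕ; ‵inject₁)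
  open import Data.List.Base using (List; []; _∷_; _++_; map; filter; upTo; applyUpTo; concatMap; length)
  import Data.List.Properties as List
  open import Data.Nat.Base
  open import Data.Nat.ListAction using (sum)
  open import Data.Bool.Base using (if_then_else_)
  open import Data.Nat.Properties
  open import Data.Nat.Tactic.RingSolver using (solve-∀)
  open import Data.Product using (_×_; _,_; ∃-syntax; proj₁; proj₂)
  open import Data.Sum.Base using (_⊎_; inj₁; inj₂)
  open import Data.Vec.Base using (Vec; []; _∷_; _∷ʳ_; lookup)
  open import Function.Base using (_∘_)
  open import Relation.Binary.PropositionalEquality
  open import Relation.Nullary
  open import Relation.Nullary.Decidable using (dec-true; dec-false)

  private variable
    n : ℕ

  lookup-∷ʳ-inject₁ : (v : Vec ℕ n) (x : ℕ) (i : Fin n) → lookup (v ∷ʳ x) (inject₁ i) ≡ lookup v i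
  lookup-∷ʳ-inject₁ (y ∷ v) x zero    = refl
  lookup-∷ʳ-inject₁ (y ∷ v) x (suc i) = lookup-∷ʳ-inject₁ v x i

  lookup-∷ʳ-fromℕ : (v : Vec ℕ n) (x : ℕ) → lookup (v ∷ʳ x) (fromℕ n) ≡ x
  lookup-∷ʳ-fromℕ []      x = refl
  lookup-∷ʳ-fromℕ (y ∷ v) x = lookup-∷ʳ-fromℕ v x

  -- The condition that no bad triple of `v ∷ʳ x` has the new entry as its third member. Triples
  -- inside `v` are left to `Avoids v`.
  Extends : Vec ℕ n → ℕ → Set
  Extends {n} v x = ∀ (i j : Fin n) → toℕ i < toℕ j → lookup v i ≢ lookup v j → lookup v j ≢ x → lookup v i < x

  inject₁<fromℕ : (i : Fin n) → toℕ (inject₁ i) < toℕ (fromℕ n)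
  inject₁<fromℕ {n} i = subst₂ _<_ (sym (toℕ-inject₁ i)) (sym (toℕ-fromℕ n)) (toℕ<n i)

  inject₁-< : {i j : Fin n} → toℕ i < toℕ j → toℕ (inject₁ i) < toℕ (inject₁ j)
  inject₁-< {i = i} {j} = subst₂ _<_ (sym (toℕ-inject₁ i)) (sym (toℕ-inject₁ j))

  inject₁-<⁻ : {i j : Fin n} → toℕ (inject₁ i) < toℕ (inject₁ j) → toℕ i < toℕ j
  inject₁-<⁻ {i = i} {j} = subst₂ _<_ (toℕ-inject₁ i) (toℕ-inject₁ j)

  fromℕ≮ : (j : Fin (suc n)) → ¬ toℕ (fromℕ n) < toℕ j
  fromℕ≮ {n} j lt = <⇒≱ lt (subst (toℕ j ≤_) (sym (toℕ-fromℕ n)) (s≤s⁻¹ (toℕ<n j)))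

  avoids-init : (v : Vec ℕ n) (x : ℕ) → Avoids (v ∷ʳ x) → Avoids v
  avoids-init v x av (i , j , k , i<j , j<k , i≢j , j≢k , k≤i) = av
    ( inject₁ i , inject₁ j , inject₁ k , inject₁-< i<j , inject₁-< j<k
    , (λ eq → i≢j (trans (sym (at i)) (trans eq (at j))))
    , (λ eq → j≢k (trans (sym (at j)) (trans eq (at k))))
    , subst₂ _≤_ (sym (at k)) (sym (at i)) k≤i )
    where at = lookup-∷ʳ-inject₁ v x

  avoids⇒extends : (v : Vec ℕ n) (x : ℕ) → Avoids (v ∷ʳ x) → Extends v x
  avoids⇒extends {n} v x av i j i<j i≢j j≢x = ≰⇒> λ x≤i → av
    ( inject₁ i , inject₁ j , fromℕ n , inject₁-< i<j , inject₁<fromℕ j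
    , (λ eq → i≢j (trans (sym (at i)) (trans eq (at j))))
    , (λ eq → j≢x (trans (sym (at j)) (trans eq (lookup-∷ʳ-fromℕ v x))))
    , subst₂ _≤_ (sym (lookup-∷ʳ-fromℕ v x)) (sym (at i)) x≤i )
    where at = lookup-∷ʳ-inject₁ v x

  avoids-∷ʳ : (v : Vec ℕ n) (x : ℕ) → Avoids v → Extends v x → Avoids (v ∷ʳ x)
  avoids-∷ʳ v x av ext (i , j , k , i<j , j<k , i≢j , j≢k , k≤i) with view i | view j | view k
  ... | ‵fromℕ     | _          | _          = fromℕ≮ j i<j
  ... | ‵inject₁ i | ‵fromℕ     | _          = fromℕ≮ k j<k
  ... | ‵inject₁ i | ‵inject₁ j | ‵fromℕ     =
    <⇒≱ (ext i j (inject₁-<⁻ i<j) (λ eq → i≢j (trans (at i) (trans eq (sym (at j)))))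
           (λ eq → j≢k (trans (at j) (trans eq (sym (lookup-∷ʳ-fromℕ v x))))))
        (subst₂ _≤_ (lookup-∷ʳ-fromℕ v x) (at i) k≤i)
    where at = lookup-∷ʳ-inject₁ v x
  ... | ‵inject₁ i | ‵inject₁ j | ‵inject₁ k = av
    ( i , j , k , inject₁-<⁻ i<j , inject₁-<⁻ j<k
    , (λ eq → i≢j (trans (at i) (trans eq (sym (at j)))))
    , (λ eq → j≢k (trans (at j) (trans eq (sym (at k)))))
    , subst₂ _≤_ (at k) (at i) k≤i )
    where at = lookup-∷ʳ-inject₁ v x

  extends-init : (v : Vec ℕ n) (y x : ℕ) → Extends (v ∷ʳ y) x → Extends v x
  extends-init v y x ext i j i<j i≢j j≢x = subst (_< x) (at i) (ext (inject₁ i) (inject₁ j) (inject₁-< i<j)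
    (λ eq → i≢j (trans (sym (at i)) (trans eq (at j)))) (λ eq → j≢x (trans (sym (at j)) eq)))
    where at = lookup-∷ʳ-inject₁ v y

  extends-last : (v : Vec ℕ n) (y x : ℕ) → Extends (v ∷ʳ y) x → y ≢ x → ∀ i → lookup v i ≢ y → lookup v i < x
  extends-last {n} v y x ext y≢x i i≢y = subst (_< x) (at i) (ext (inject₁ i) (fromℕ n) (inject₁<fromℕ i)
    (λ eq → i≢y (trans (sym (at i)) (trans eq (lookup-∷ʳ-fromℕ v y))))
    (λ eq → y≢x (trans (sym (lookup-∷ʳ-fromℕ v y)) eq)))
    where at = lookup-∷ʳ-inject₁ v y

  extends-∷ʳ : (v : Vec ℕ n) (y x : ℕ) → Extends v x → (y ≢ x → ∀ i → lookup v i ≢ y → lookup v i < x) → Extends (v ∷ʳ y) x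
  extends-∷ʳ v y x ext last i j i<j i≢j j≢x with view i | view j
  ... | ‵fromℕ     | _          = ⊥-elim (fromℕ≮ j i<j)
  ... | ‵inject₁ i | ‵fromℕ     = subst (_< x) (sym (at i)) (last (λ eq → j≢x (trans (lookup-∷ʳ-fromℕ v y) eq)) i
      (λ eq → i≢j (trans (at i) (trans eq (sym (lookup-∷ʳ-fromℕ v y))))))
    where at = lookup-∷ʳ-inject₁ v y
  ... | ‵inject₁ i | ‵inject₁ j = subst (_< x) (sym (at i)) (ext i j (inject₁-<⁻ i<j)
      (λ eq → i≢j (trans (at i) (trans eq (sym (at j))))) (λ eq → j≢x (trans (at j) eq)))
    where at = lookup-∷ʳ-inject₁ v y

  -- States of avoiding sequences and the number of their continuations.

  -- A state is (q , ℓ): ℓ is the last entry and q is the least bound strictly above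
  -- all entries before the last run (q = 0 if there are none).
  State : Set
  State = ℕ × ℕ

  Allowed : State → ℕ → Set
  Allowed (q , ℓ) x = x ≡ ℓ ⊎ q ≤ x

  allowed? : ∀ s x → Dec (Allowed s x)
  allowed? (q , ℓ) x = (x ≟ ℓ) ⊎-dec (q ≤? x)

  -- A different value ends the run of `ℓ`, so `ℓ` joins the entries that `q` must exceed; a
  -- repeated value only prolongs the run.
  step : State → ℕ → State
  step (q , ℓ) x with x ≟ ℓ
  ... | yes _ = q , ℓ
  ... | no  _ = q ⊔ suc ℓ , x

  -- The first two fields say that `s` determines which entries may follow `v`. The last two are the
  -- invariant that carries this through a further entry: `bounded` yields completeness of the new
  -- state, `attained` its soundness.
  record Describes (v : Vec ℕ n) (s : State) : Set where
    field
      sound    : ∀ {x} → Extends v x → Allowed s x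
      complete : ∀ {x} → Allowed s x → Extends v x
      bounded  : ∀ i → lookup v i ≡ proj₂ s ⊎ lookup v i < proj₁ s
      attained : ∃[ i ] lookup v i ≡ proj₂ s
  open Describes

  describes-[0] : Describes (0 ∷ []) (0 , 0)
  describes-[0] .sound    _ = inj₂ z≤n
  describes-[0] .complete _ zero zero ()
  describes-[0] .bounded  zero = inj₁ refl
  describes-[0] .attained = zero , refl

  -- If `y` repeats `ℓ`, the entries different from `y` are below `q` by `bounded`, so nothing new
  -- is demanded. Otherwise all earlier entries are below `q ⊔ suc ℓ`. Conversely, an entry `x ≢ y`
  -- must exceed `ℓ`, since `ℓ` occurs in `v` and differs from `y`; then `x ≢ ℓ`, and the old
  -- condition leaves only `q ≤ x`.
  describes-∷ʳ : {v : Vec ℕ n} {s : State} → Describes v s → ∀ {y} → Allowed s y → Describes (v ∷ʳ y) (step s y)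
  describes-∷ʳ {n} {v} {q , ℓ} d {y} ok with y ≟ ℓ
  ... | yes refl = record
    { sound    = λ {x} ext → d .sound (extends-init v y x ext)
    ; complete = λ {x} all → extends-∷ʳ v y x (d .complete all) (below all)
    ; bounded  = bounded′
    ; attained = fromℕ n , lookup-∷ʳ-fromℕ v y
    }
    where
    below : ∀ {x} → Allowed (q , y) x → y ≢ x → ∀ i → lookup v i ≢ y → lookup v i < x
    below (inj₁ x≡y) y≢x i i≢y = ⊥-elim (y≢x (sym x≡y))
    below (inj₂ q≤x) y≢x i i≢y with d .bounded i
    ... | inj₁ i≡y = ⊥-elim (i≢y i≡y)
    ... | inj₂ i<q = <-≤-trans i<q q≤x
    bounded′ : ∀ i → lookup (v ∷ʳ y) i ≡ y ⊎ lookup (v ∷ʳ y) i < q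
    bounded′ i with view i
    ... | ‵fromℕ     = inj₁ (lookup-∷ʳ-fromℕ v y)
    ... | ‵inject₁ i = subst (λ z → z ≡ y ⊎ z < q) (sym (lookup-∷ʳ-inject₁ v y i)) (d .bounded i)
  ... | no y≢ℓ = record
    { sound    = sound′
    ; complete = complete′
    ; bounded  = bounded′
    ; attained = fromℕ n , lookup-∷ʳ-fromℕ v y
    }
    where
    below : ∀ i → lookup v i < q ⊔ suc ℓ
    below i with d .bounded i
    ... | inj₁ i≡ℓ = subst (_< q ⊔ suc ℓ) (sym i≡ℓ) (m≤n⊔m q (suc ℓ))
    ... | inj₂ i<q = <-≤-trans i<q (m≤m⊔n q (suc ℓ))
    sound′ : ∀ {x} → Extends (v ∷ʳ y) x → x ≡ y ⊎ q ⊔ suc ℓ ≤ x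
    sound′ {x} ext with x ≟ y
    ... | yes x≡y = inj₁ x≡y
    ... | no  x≢y = inj₂ (⊔-lub q≤x ℓ<x)
      where
      ℓ<x : ℓ < x
      ℓ<x with i , i≡ℓ ← d .attained = subst (_< x) i≡ℓ
        (extends-last v y x ext (x≢y ∘ sym) i (λ i≡y → y≢ℓ (trans (sym i≡y) i≡ℓ)))
      q≤x : q ≤ x
      q≤x with d .sound (extends-init v y x ext)
      ... | inj₁ refl = ⊥-elim (<-irrefl refl ℓ<x)
      ... | inj₂ q≤x  = q≤x
    complete′ : ∀ {x} → x ≡ y ⊎ q ⊔ suc ℓ ≤ x → Extends (v ∷ʳ y) x
    complete′ (inj₁ refl)    = extends-∷ʳ v y y (d .complete ok) (λ y≢y → ⊥-elim (y≢y refl))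
    complete′ {x} (inj₂ b≤x) = extends-∷ʳ v y x (d .complete (inj₂ (≤-trans (m≤m⊔n q (suc ℓ)) b≤x)))
      (λ _ i _ → <-≤-trans (below i) b≤x)
    bounded′ : ∀ i → lookup (v ∷ʳ y) i ≡ y ⊎ lookup (v ∷ʳ y) i < q ⊔ suc ℓ
    bounded′ i with view i
    ... | ‵fromℕ     = inj₁ (lookup-∷ʳ-fromℕ v y)
    ... | ‵inject₁ i = inj₂ (subst (_< q ⊔ suc ℓ) (sym (lookup-∷ʳ-inject₁ v y i)) (below i))

  -- `k` entries are still to be appended and `n` is the present length, so the next entry ranges
  -- over `0` to `n`.
  count : ℕ → ℕ → State → ℕ
  branch : ℕ → ℕ → State → ℕ → ℕ
  count zero    n s = 1
  count (suc k) n s = sum (applyUpTo (branch k n s) (suc n))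
  branch k n s x = if does (allowed? s x) then count k (suc n) (step s x) else 0

  branch-allowed : ∀ k n s {x} → Allowed s x → branch k n s x ≡ count k (suc n) (step s x)
  branch-allowed k n s {x} ok = cong (λ d → if d then count k (suc n) (step s x) else 0) (dec-true (allowed? s x) ok)

  branch-forbidden : ∀ k n s {x} → ¬ Allowed s x → branch k n s x ≡ 0
  branch-forbidden k n s {x} ¬ok = cong (λ d → if d then count k (suc n) (step s x) else 0) (dec-false (allowed? s x) ¬ok)

  step-repeat : ∀ q ℓ → step (q , ℓ) ℓ ≡ (q , ℓ)
  step-repeat q ℓ with ℓ ≟ ℓ
  ... | yes _ = refl
  ... | no  ℓ≢ℓ = ⊥-elim (ℓ≢ℓ refl)

  step-new : ∀ q ℓ {x} → x ≢ ℓ → step (q , ℓ) x ≡ (q ⊔ suc ℓ , x)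
  step-new q ℓ {x} x≢ℓ with x ≟ ℓ
  ... | yes x≡ℓ = ⊥-elim (x≢ℓ x≡ℓ)
  ... | no  _   = refl

  branch-repeat : ∀ k n q ℓ → branch k n (q , ℓ) ℓ ≡ count k (suc n) (q , ℓ)
  branch-repeat k n q ℓ = trans (branch-allowed k n (q , ℓ) (inj₁ refl)) (cong (count k (suc n)) (step-repeat q ℓ))

  branch-new : ∀ k n q ℓ {x} → q ≤ x → x ≢ ℓ → branch k n (q , ℓ) x ≡ count k (suc n) (q ⊔ suc ℓ , x)
  branch-new k n q ℓ q≤x x≢ℓ = trans (branch-allowed k n (q , ℓ) (inj₂ q≤x)) (cong (count k (suc n)) (step-new q ℓ x≢ℓ))

  -- From the filtered enumeration to counting by states.

  extend : List (Vec ℕ n) → List (Vec ℕ (suc n))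
  extend {n} = concatMap (λ v → map (v ∷ʳ_) (upTo (suc n)))

  -- Counts the avoiding sequences among all `k`-fold extensions of `vs`. Being additive in `vs`, it
  -- localises the enumeration at a single prefix.
  total : ℕ → List (Vec ℕ n) → ℕ
  total zero    vs = length (filter avoids? vs)
  total (suc k) vs = total k (extend vs)

  total-invSeqs : ∀ k n → total k (invSeqs n) ≡ I (k + n)
  total-invSeqs zero    n = refl
  total-invSeqs (suc k) n = trans (total-invSeqs k (suc n)) (cong I (+-suc k n))

  total-++ : ∀ k (vs ws : List (Vec ℕ n)) → total k (vs ++ ws) ≡ total k vs + total k ws
  total-++ zero    vs ws = trans (cong length (List.filter-++ avoids? vs ws)) (List.length-++ (filter avoids? vs))
  total-++ (suc k) vs ws = trans (cong (total k) (List.concatMap-++ _ vs ws)) (total-++ k (extend vs) (extend ws))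

  total-[] : ∀ {n} k → total k ([] {A = Vec ℕ n}) ≡ 0
  total-[] zero    = refl
  total-[] (suc k) = total-[] k

  total-map : ∀ {a} {A : Set a} k (f : A → Vec ℕ n) xs → total k (map f xs) ≡ sum (map (λ x → total k (f x ∷ [])) xs)
  total-map k f []       = total-[] k
  total-map k f (x ∷ xs) = trans (total-++ k (f x ∷ []) (map f xs)) (cong (total k (f x ∷ []) +_) (total-map k f xs))

  sum-cong : ∀ n {f g : ℕ → ℕ} → (∀ i → i < n → f i ≡ g i) → sum (applyUpTo f n) ≡ sum (applyUpTo g n)
  sum-cong zero    eq = refl
  sum-cong (suc n) eq = cong₂ _+_ (eq 0 z<s) (sum-cong n (λ i i<n → eq (suc i) (s<s i<n)))

  sum-const : ∀ n c → sum (applyUpTo (λ _ → c) n) ≡ n * c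
  sum-const zero    c = refl
  sum-const (suc n) c = cong (c +_) (sum-const n c)

  sum-split : ∀ m n f → sum (applyUpTo f (m + n)) ≡ sum (applyUpTo f m) + sum (applyUpTo (λ i → f (m + i)) n)
  sum-split zero    n f = refl
  sum-split (suc m) n f = trans (cong (f 0 +_) (sum-split m n (f ∘ suc))) (sym (+-assoc (f 0) _ _))

  sum-zero : ∀ n {f : ℕ → ℕ} → (∀ i → i < n → f i ≡ 0) → sum (applyUpTo f n) ≡ 0
  sum-zero n eq = trans (sum-cong n eq) (trans (sum-const n 0) (*-zeroʳ n))

  sum-single : ∀ n {f : ℕ → ℕ} {j} → j < n → (∀ i → i < n → i ≢ j → f i ≡ 0) → sum (applyUpTo f n) ≡ f j
  sum-single (suc n) {f} {zero}  _   eq = trans (cong (f 0 +_) (sum-zero n (λ i i<n → eq (suc i) (s<s i<n) λ ()))) (+-identityʳ (f 0))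
  sum-single (suc n) {f} {suc j} j<n eq = cong₂ _+_ (eq 0 z<s λ ())
    (sum-single n (s<s⁻¹ j<n) (λ i i<n i≢j → eq (suc i) (s<s i<n) (i≢j ∘ suc-injective)))

  total-extensions : ∀ k (v : Vec ℕ n) → total (suc k) (v ∷ []) ≡ sum (applyUpTo (λ x → total k ((v ∷ʳ x) ∷ [])) (suc n))
  total-extensions {n} k v = begin
    total k (map (v ∷ʳ_) (upTo (suc n)) ++ [])
      ≡⟨ cong (total k) (List.++-identityʳ (map (v ∷ʳ_) (upTo (suc n)))) ⟩
    total k (map (v ∷ʳ_) (upTo (suc n)))
      ≡⟨ total-map k (v ∷ʳ_) (upTo (suc n)) ⟩
    sum (map (λ x → total k ((v ∷ʳ x) ∷ [])) (upTo (suc n)))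
      ≡⟨ cong sum (List.map-upTo (λ x → total k ((v ∷ʳ x) ∷ [])) (suc n)) ⟩
    sum (applyUpTo (λ x → total k ((v ∷ʳ x) ∷ [])) (suc n)) ∎
    where open ≡-Reasoning

  -- A bad triple persists in every extension, so the whole subtree above `v` contributes nothing.
  total-bad : ∀ k (v : Vec ℕ n) → ¬ Avoids v → total k (v ∷ []) ≡ 0
  total-bad zero    v bad = cong length (List.filter-reject avoids? bad)
  total-bad {n} (suc k) v bad = trans (total-extensions k v)
    (sum-zero (suc n) (λ x _ → total-bad k (v ∷ʳ x) (bad ∘ avoids-init v x)))

  -- Replaces filtering at the end by pruning at each entry: an allowed entry preserves avoidance
  -- and updates the state, a forbidden one creates a bad triple and is discarded by `total-bad`.
  total-described : ∀ k (v : Vec ℕ n) s → Avoids v → Describes v s → total k (v ∷ []) ≡ count k n s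
  total-described zero    v s av d = cong length (List.filter-accept avoids? av)
  total-described {n} (suc k) v s av d = trans (total-extensions k v) (sum-cong (suc n) (λ x _ → eq x))
    where
    eq : ∀ x → total k ((v ∷ʳ x) ∷ []) ≡ branch k n s x
    eq x with allowed? s x
    ... | yes ok = trans (total-described k (v ∷ʳ x) (step s x) (avoids-∷ʳ v x av (d .complete ok)) (describes-∷ʳ d ok))
                         (sym (branch-allowed k n s ok))
    ... | no ¬ok = trans (total-bad k (v ∷ʳ x) (¬ok ∘ d .sound ∘ avoids⇒extends v x))
                         (sym (branch-forbidden k n s ¬ok))

  -- Linear recurrences for the counts.

  -- A state (q , q + u) of length 1 + q + u + v has A k v + u * B k v extensions by k entries,
  -- a state of length q + w with ℓ < q has A k w of them.
  A B S T : ℕ → ℕ → ℕ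
  A zero    v = 1
  A (suc k) v = A k (suc v) + S k v
  B zero    v = 0
  B (suc k) v = B k (suc v) + A k (suc v)
  S k zero    = A k 0
  S k (suc v) = S k v + A k (suc v) + T k v
  T k zero    = B k 0
  T k (suc v) = T k v + B k (suc v)

  T-sum : ∀ k v → sum (applyUpTo (λ i → B k (v ∸ i)) (suc v)) ≡ T k v
  T-sum k zero    = +-identityʳ (B k 0)
  T-sum k (suc v) = trans (cong (B k (suc v) +_) (T-sum k v)) (+-comm (B k (suc v)) (T k v))

  sum-+ : ∀ n f g → sum (applyUpTo (λ i → f i + g i) n) ≡ sum (applyUpTo f n) + sum (applyUpTo g n)
  sum-+ zero    f g = refl
  sum-+ (suc n) f g = trans (cong (f 0 + g 0 +_) (sum-+ n (f ∘ suc) (g ∘ suc))) (interchange (f 0) (g 0) _ _)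
    where
    interchange : ∀ a b c d → a + b + (c + d) ≡ a + c + (b + d)
    interchange = solve-∀

  -- Passing from `v` to `suc v` raises the weight of each old `B` term by one. The extra copies add
  -- up to `T k v`, which is the origin of the term `T` in the recursion for `S`.
  S-sum : ∀ k v → sum (applyUpTo (λ i → A k (v ∸ i) + i * B k (v ∸ i)) (suc v)) ≡ S k v
  S-sum k zero    = trans (+-identityʳ _) (+-identityʳ (A k 0))
  S-sum k (suc v) = begin
    A k (suc v) + 0 + sum (applyUpTo (λ i → A k (v ∸ i) + (B k (v ∸ i) + i * B k (v ∸ i))) (suc v))
      ≡⟨ cong₂ _+_ (+-identityʳ (A k (suc v)))
           (sum-cong (suc v) (λ i _ → assoc (A k (v ∸ i)) (B k (v ∸ i)) (i * B k (v ∸ i)))) ⟩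
    A k (suc v) + sum (applyUpTo (λ i → (A k (v ∸ i) + i * B k (v ∸ i)) + B k (v ∸ i)) (suc v))
      ≡⟨ cong (A k (suc v) +_) (sum-+ (suc v) (λ i → A k (v ∸ i) + i * B k (v ∸ i)) (λ i → B k (v ∸ i))) ⟩
    A k (suc v) + (sum (applyUpTo (λ i → A k (v ∸ i) + i * B k (v ∸ i)) (suc v)) + sum (applyUpTo (λ i → B k (v ∸ i)) (suc v)))
      ≡⟨ cong (A k (suc v) +_) (cong₂ _+_ (S-sum k v) (T-sum k v)) ⟩
    A k (suc v) + (S k v + T k v)
      ≡⟨ rearrange (A k (suc v)) (S k v) (T k v) ⟩
    S k v + A k (suc v) + T k v ∎
    where
    open ≡-Reasoning
    assoc : ∀ a b c → a + (b + c) ≡ (a + c) + b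
    assoc = solve-∀
    rearrange : ∀ a b c → a + (b + c) ≡ b + a + c
    rearrange = solve-∀

  -- The possible next entries form four blocks: `q` forbidden ones, `u` falls below `ℓ` but not
  -- below `q`, one repetition of `ℓ`, and `suc v` rises. All falls contribute the same number,
  -- which keeps the count linear in `u`. In `count-down`, the only entry allowed below `q` is `ℓ`
  -- itself.
  count-up : ∀ k q u v → count k (suc (q + u + v)) (q , q + u) ≡ A k v + u * B k v
  count-down : ∀ k q ℓ w → ℓ < q → count k (q + w) (q , ℓ) ≡ A k w

  count-up zero    q u v = sym (cong (1 +_) (*-zeroʳ u))
  count-up (suc k) q u v = begin
    sum (applyUpTo f (suc len))
      ≡⟨ cong (sum ∘ applyUpTo f) (length-eq q u v) ⟩
    sum (applyUpTo f (q + (u + suc (suc v))))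
      ≡⟨ sum-split q _ f ⟩
    sum (applyUpTo f q) + sum (applyUpTo (λ i → f (q + i)) (u + suc (suc v)))
      ≡⟨ cong₂ _+_ (sum-zero q forbidden) (sum-split u _ (λ i → f (q + i))) ⟩
    sum (applyUpTo (λ i → f (q + i)) u) + (f (q + (u + 0)) + sum (applyUpTo (λ i → f (q + (u + suc i))) (suc v)))
      ≡⟨ cong₂ _+_ (trans (sum-cong u fall) (sum-const u _)) (cong₂ _+_ stay (trans (sum-cong (suc v) rise) (S-sum k v))) ⟩
    u * A k (suc v) + (A k (suc v) + u * B k (suc v) + S k v)
      ≡⟨ collect u (A k (suc v)) (B k (suc v)) (S k v) ⟩
    A k (suc v) + S k v + u * (B k (suc v) + A k (suc v)) ∎
    where
    open ≡-Reasoning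
    len = suc (q + u + v)
    f = branch k len (q , q + u)
    length-eq : ∀ q u v → suc (suc (q + u + v)) ≡ q + (u + suc (suc v))
    length-eq = solve-∀
    collect : ∀ u a b s → u * a + (a + u * b + s) ≡ a + s + u * (b + a)
    collect = solve-∀
    q⊔ : q ⊔ suc (q + u) ≡ suc (q + u)
    q⊔ = m≤n⇒m⊔n≡n (m≤n⇒m≤1+n (m≤m+n q u))
    forbidden : ∀ i → i < q → f i ≡ 0
    forbidden i i<q = branch-forbidden k len (q , q + u)
      λ { (inj₁ refl) → <⇒≱ i<q (m≤m+n q u) ; (inj₂ q≤i) → <⇒≱ i<q q≤i }
    fall : ∀ i → i < u → f (q + i) ≡ A k (suc v)
    fall i i<u = begin
      f (q + i)                                       ≡⟨ branch-new k len q (q + u) (m≤m+n q i) (<⇒≢ q+i<q+u) ⟩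
      count k (suc len) (q ⊔ suc (q + u) , q + i)       ≡⟨ cong₂ (λ m r → count k m (r , q + i)) (cong suc (sym (+-suc (q + u) v))) q⊔ ⟩
      count k (suc (q + u) + suc v) (suc (q + u) , q + i) ≡⟨ count-down k (suc (q + u)) (q + i) (suc v) (m<n⇒m<1+n q+i<q+u) ⟩
      A k (suc v)                                     ∎
      where
      q+i<q+u : q + i < q + u
      q+i<q+u = +-monoʳ-< q i<u
    stay : f (q + (u + 0)) ≡ A k (suc v) + u * B k (suc v)
    stay = begin
      f (q + (u + 0))                                 ≡⟨ cong (λ m → f (q + m)) (+-identityʳ u) ⟩
      f (q + u)                                       ≡⟨ branch-repeat k len q (q + u) ⟩
      count k (suc len) (q , q + u)                     ≡⟨ cong (λ m → count k (suc m) (q , q + u)) (+-suc (q + u) v) ⟨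
      count k (suc (q + u + suc v)) (q , q + u)       ≡⟨ count-up k q u (suc v) ⟩
      A k (suc v) + u * B k (suc v)                   ∎
    -- A rise makes `suc (q + u)` the new bound; the new entry exceeds it by `i`, leaving room
    -- `v ∸ i` above.
    rise : ∀ i → i < suc v → f (q + (u + suc i)) ≡ A k (v ∸ i) + i * B k (v ∸ i)
    rise i i<1+v = begin
      f (q + (u + suc i))
        ≡⟨ branch-new k len q (q + u) (m≤m+n q _) (λ eq → m+1+n≢m (q + u) (trans (+-assoc q u (suc i)) eq)) ⟩
      count k (suc len) (q ⊔ suc (q + u) , q + (u + suc i))
        ≡⟨ cong₂ (count k) (cong suc (cong suc (trans (cong (q + u +_) (sym (m+[n∸m]≡n (s≤s⁻¹ i<1+v)))) (sym (+-assoc (q + u) i (v ∸ i))))))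
                           (cong₂ _,_ q⊔ (trans (sym (+-assoc q u (suc i))) (+-suc (q + u) i))) ⟩
      count k (suc (suc (q + u) + i + (v ∸ i))) (suc (q + u) , suc (q + u) + i)
        ≡⟨ count-up k (suc (q + u)) i (v ∸ i) ⟩
      A k (v ∸ i) + i * B k (v ∸ i) ∎

  count-down zero    q ℓ w ℓ<q = refl
  count-down (suc k) q ℓ w ℓ<q = begin
    sum (applyUpTo f (suc (q + w)))
      ≡⟨ cong (sum ∘ applyUpTo f) (+-suc q w) ⟨
    sum (applyUpTo f (q + suc w))
      ≡⟨ sum-split q (suc w) f ⟩
    sum (applyUpTo f q) + sum (applyUpTo (λ i → f (q + i)) (suc w))
      ≡⟨ cong₂ _+_ (trans (sum-single q ℓ<q forbidden) stay) (trans (sum-cong (suc w) rise) (S-sum k w)) ⟩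
    A k (suc w) + S k w ∎
    where
    open ≡-Reasoning
    f = branch k (q + w) (q , ℓ)
    forbidden : ∀ i → i < q → i ≢ ℓ → f i ≡ 0
    forbidden i i<q i≢ℓ = branch-forbidden k (q + w) (q , ℓ)
      λ { (inj₁ i≡ℓ) → i≢ℓ i≡ℓ ; (inj₂ q≤i) → <⇒≱ i<q q≤i }
    stay : f ℓ ≡ A k (suc w)
    stay = begin
      f ℓ                            ≡⟨ branch-repeat k (q + w) q ℓ ⟩
      count k (suc (q + w)) (q , ℓ)  ≡⟨ cong (λ m → count k m (q , ℓ)) (+-suc q w) ⟨
      count k (q + suc w) (q , ℓ)    ≡⟨ count-down k q ℓ (suc w) ℓ<q ⟩
      A k (suc w)                    ∎
    rise : ∀ i → i < suc w → f (q + i) ≡ A k (w ∸ i) + i * B k (w ∸ i)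
    rise i i<1+w = begin
      f (q + i)
        ≡⟨ branch-new k (q + w) q ℓ (m≤m+n q i) (≢-sym (<⇒≢ (<-≤-trans ℓ<q (m≤m+n q i)))) ⟩
      count k (suc (q + w)) (q ⊔ suc ℓ , q + i)
        ≡⟨ cong₂ (λ m r → count k m (r , q + i))
             (cong suc (trans (cong (q +_) (sym (m+[n∸m]≡n (s≤s⁻¹ i<1+w)))) (sym (+-assoc q i (w ∸ i)))))
             (m≥n⇒m⊔n≡m ℓ<q) ⟩
      count k (suc (q + i + (w ∸ i))) (q , q + i)
        ≡⟨ count-up k q i (w ∸ i) ⟩
      A k (w ∸ i) + i * B k (w ∸ i) ∎

  -- Every nonempty inversion sequence starts with `0`, which is described by the state `(0 , 0)`.
  I-suc : ∀ k → I (suc k) ≡ A k 0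
  I-suc k = begin
    I (suc k)                  ≡⟨ cong I (+-comm k 1) ⟨
    I (k + 1)                  ≡⟨ total-invSeqs k 1 ⟨
    total k ((0 ∷ []) ∷ [])    ≡⟨ total-described k (0 ∷ []) (0 , 0) (λ { (zero , zero , _ , () , _) }) describes-[0] ⟩
    count k 1 (0 , 0)          ≡⟨ count-up k 0 0 0 ⟩
    A k 0 + 0                  ≡⟨ +-identityʳ (A k 0) ⟩
    A k 0                      ∎
    where open ≡-Reasoning

  -- The values are computed from the recurrences for `A`, not by listing inversion sequences.
  I-values : map I (upTo 8) ≡ 1 ∷ 1 ∷ 2 ∷ 5 ∷ 15 ∷ 51 ∷ 188 ∷ 733 ∷ []
  I-values = List.map-cong I≗I′ (upTo 8)
    where
    I′ : ℕ → ℕ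
    I′ zero    = 1
    I′ (suc k) = A k 0
    I≗I′ : ∀ n → I n ≡ I′ n
    I≗I′ zero    = refl
    I≗I′ (suc k) = I-suc k

-- The coefficient ring `Q5`.

module PowerSeries where

  open import Algebra.Bundles using (CommutativeRing)
  open import Algebra.Structures using (IsCommutativeRing)
  import Algebra.Properties.CommutativeSemigroup as CommutativeSemigroupProperties
  open import Data.Nat as ℕ using (ℕ; zero; suc; _∸_)
  import Data.Nat.Properties as ℕ
  open import Data.Integer using (+_)
  open import Data.Rational as ℚ using (_/_; 0ℚ; 1ℚ)
  import Data.Rational.Properties as ℚ
  import Data.Rational.Solver as ℚ
  open import Data.Product using (_,_)
  open import Level using (0ℓ)
  open import Function.Base using (_∘_)
  open import Relation.Binary.Definitions using (DecidableEquality)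
  open import Relation.Binary.PropositionalEquality
  open import Relation.Nullary using (yes; no)

  Q5-assoc : ∀ x y z → (x ⊗ y) ⊗ z ≡ x ⊗ (y ⊗ z)
  Q5-assoc (a +√5· b) (c +√5· d) (e +√5· f) = cong₂ _+√5·_
    (solve 6 (λ a b c d e f →
        (a :* c :+ con (+ 5 / 1) :* (b :* d)) :* e :+ con (+ 5 / 1) :* ((a :* d :+ b :* c) :* f) :=
        a :* (c :* e :+ con (+ 5 / 1) :* (d :* f)) :+ con (+ 5 / 1) :* (b :* (c :* f :+ d :* e)))
      refl a b c d e f)
    (solve 6 (λ a b c d e f →
        (a :* c :+ con (+ 5 / 1) :* (b :* d)) :* f :+ (a :* d :+ b :* c) :* e :=
        a :* (c :* f :+ d :* e) :+ b :* (c :* e :+ con (+ 5 / 1) :* (d :* f)))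
      refl a b c d e f)
    where open ℚ.+-*-Solver

  Q5-comm : ∀ x y → x ⊗ y ≡ y ⊗ x
  Q5-comm (a +√5· b) (c +√5· d) = cong₂ _+√5·_
    (cong₂ ℚ._+_ (ℚ.*-comm a c) (cong ((+ 5 / 1) ℚ.*_) (ℚ.*-comm b d)))
    (trans (ℚ.+-comm (a ℚ.* d) (b ℚ.* c)) (cong₂ ℚ._+_ (ℚ.*-comm b c) (ℚ.*-comm a d)))

  Q5-identityˡ : ∀ x → 𝟙 ⊗ x ≡ x
  Q5-identityˡ (a +√5· b) = cong₂ _+√5·_
    (solve 2 (λ a b → con 1ℚ :* a :+ con (+ 5 / 1) :* (con 0ℚ :* b) := a) refl a b)
    (solve 2 (λ a b → con 1ℚ :* b :+ con 0ℚ :* a := b) refl a b)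
    where open ℚ.+-*-Solver

  Q5-distribˡ : ∀ x y z → x ⊗ (y ⊕ z) ≡ (x ⊗ y) ⊕ (x ⊗ z)
  Q5-distribˡ (a +√5· b) (c +√5· d) (e +√5· f) = cong₂ _+√5·_
    (solve 6 (λ a b c d e f →
        a :* (c :+ e) :+ con (+ 5 / 1) :* (b :* (d :+ f)) :=
        (a :* c :+ con (+ 5 / 1) :* (b :* d)) :+ (a :* e :+ con (+ 5 / 1) :* (b :* f)))
      refl a b c d e f)
    (solve 6 (λ a b c d e f →
        a :* (d :+ f) :+ b :* (c :+ e) := (a :* d :+ b :* c) :+ (a :* f :+ b :* e))
      refl a b c d e f)
    where open ℚ.+-*-Solver

  Q5-isCommutativeRing : IsCommutativeRing _≡_ _⊕_ _⊗_ ⊖_ 𝟘 𝟙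
  Q5-isCommutativeRing = record
    { isRing = record
      { +-isAbelianGroup = record
        { isGroup = record
          { isMonoid = record
            { isSemigroup = record
              { isMagma = isMagma _⊕_
              ; assoc = λ x y z → cong₂ _+√5·_ (ℚ.+-assoc (re x) (re y) (re z)) (ℚ.+-assoc (ir x) (ir y) (ir z))
              }
            ; identity = (λ x → cong₂ _+√5·_ (ℚ.+-identityˡ (re x)) (ℚ.+-identityˡ (ir x)))
                       , (λ x → cong₂ _+√5·_ (ℚ.+-identityʳ (re x)) (ℚ.+-identityʳ (ir x)))
            }
          ; inverse = (λ x → cong₂ _+√5·_ (ℚ.+-inverseˡ (re x)) (ℚ.+-inverseˡ (ir x)))
                    , (λ x → cong₂ _+√5·_ (ℚ.+-inverseʳ (re x)) (ℚ.+-inverseʳ (ir x)))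
          ; ⁻¹-cong = cong ⊖_
          }
        ; comm = λ x y → cong₂ _+√5·_ (ℚ.+-comm (re x) (re y)) (ℚ.+-comm (ir x) (ir y))
        }
      ; *-cong = cong₂ _⊗_
      ; *-assoc = Q5-assoc
      ; *-identity = Q5-identityˡ , λ x → trans (Q5-comm x 𝟙) (Q5-identityˡ x)
      ; distrib = Q5-distribˡ , λ x y z → trans (Q5-comm (y ⊕ z) x)
          (trans (Q5-distribˡ x y z) (cong₂ _⊕_ (Q5-comm x y) (Q5-comm x z)))
      }
    ; *-comm = Q5-comm
    }

  Q5-commutativeRing : CommutativeRing 0ℓ 0ℓ
  Q5-commutativeRing = record { isCommutativeRing = Q5-isCommutativeRing }

  module ℚ√5 = CommutativeRing Q5-commutativeRing
  open CommutativeSemigroupProperties ℚ√5.+-commutativeSemigroup using (interchange)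

  infix 4 _≟_
  _≟_ : DecidableEquality Q5
  (a +√5· b) ≟ (c +√5· d) with a ℚ.≟ c | b ℚ.≟ d
  ... | yes refl | yes refl = yes refl
  ... | no a≢c   | _        = no λ { refl → a≢c refl }
  ... | _        | no b≢d   = no λ { refl → b≢d refl }

  -- The ring of power series under convolution.

  -- Convolution satisfies  (f * g)₀ = f₀ g₀  and  (f * g)ₙ₊₁ = f₀ gₙ₊₁ + (f⁺ * g)ₙ,
  -- where f⁺ = divZ f; the ring laws follow from this by induction on the degree.

  sumTo-cong : ∀ n {f g : ℕ → Q5} → (∀ i → i ℕ.< n → f i ≡ g i) → sumTo n f ≡ sumTo n g
  sumTo-cong zero    _  = refl
  sumTo-cong (suc n) eq = cong₂ _⊕_ (sumTo-cong n (λ i i<n → eq i (ℕ.m<n⇒m<1+n i<n))) (eq n ℕ.≤-refl)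

  sumTo-head : ∀ n f → sumTo (suc n) f ≡ f 0 ⊕ sumTo n (f ∘ suc)
  sumTo-head zero    f = ℚ√5.+-comm 𝟘 (f 0)
  sumTo-head (suc n) f = trans (cong (_⊕ f (suc n)) (sumTo-head n f)) (ℚ√5.+-assoc (f 0) _ (f (suc n)))

  sumTo-⊕ : ∀ n f g → sumTo n (λ i → f i ⊕ g i) ≡ sumTo n f ⊕ sumTo n g
  sumTo-⊕ zero    f g = sym (ℚ√5.+-identityˡ 𝟘)
  sumTo-⊕ (suc n) f g = trans (cong (_⊕ (f n ⊕ g n)) (sumTo-⊕ n f g))
    (interchange (sumTo n f) (sumTo n g) (f n) (g n))

  sumTo-scale : ∀ n c f → sumTo n (λ i → c ⊗ f i) ≡ c ⊗ sumTo n f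
  sumTo-scale zero    c f = sym (ℚ√5.zeroʳ c)
  sumTo-scale (suc n) c f = trans (cong (_⊕ (c ⊗ f n)) (sumTo-scale n c f)) (sym (ℚ√5.distribˡ c (sumTo n f) (f n)))

  infix 4 _≈ₚ_
  _≈ₚ_ : PS → PS → Set
  f ≈ₚ g = ∀ n → f n ≡ g n

  *ₚ-zero : ∀ f g → (f *ₚ g) 0 ≡ f 0 ⊗ g 0
  *ₚ-zero f g = ℚ√5.+-identityˡ (f 0 ⊗ g 0)

  *ₚ-suc : ∀ f g n → (f *ₚ g) (suc n) ≡ f 0 ⊗ g (suc n) ⊕ (divZ f *ₚ g) n
  *ₚ-suc f g n = sumTo-head (suc n) (λ i → f i ⊗ g (suc n ∸ i))

  -- Splits off the last term of the convolution instead of the first; comparing the two splittings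
  -- proves commutativity by induction on the degree.
  *ₚ-sucʳ : ∀ f g n → (f *ₚ g) (suc n) ≡ (f *ₚ divZ g) n ⊕ f (suc n) ⊗ g 0
  *ₚ-sucʳ f g n = cong₂ _⊕_
    (sumTo-cong (suc n) (λ i i<1+n → cong (λ k → f i ⊗ g k) (ℕ.+-∸-assoc 1 (ℕ.s≤s⁻¹ i<1+n))))
    (cong (λ k → f (suc n) ⊗ g k) (ℕ.n∸n≡0 n))

  *ₚ-cong : ∀ {f f′ g g′} → f ≈ₚ f′ → g ≈ₚ g′ → f *ₚ g ≈ₚ f′ *ₚ g′
  *ₚ-cong f≈ g≈ n = sumTo-cong (suc n) (λ i _ → cong₂ _⊗_ (f≈ i) (g≈ (n ∸ i)))

  *ₚ-comm : ∀ f g → f *ₚ g ≈ₚ g *ₚ f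
  *ₚ-comm f g zero    = trans (*ₚ-zero f g) (trans (ℚ√5.*-comm (f 0) (g 0)) (sym (*ₚ-zero g f)))
  *ₚ-comm f g (suc n) = begin
    (f *ₚ g) (suc n)                       ≡⟨ *ₚ-suc f g n ⟩
    f 0 ⊗ g (suc n) ⊕ (divZ f *ₚ g) n      ≡⟨ cong₂ _⊕_ (ℚ√5.*-comm (f 0) _) (*ₚ-comm (divZ f) g n) ⟩
    g (suc n) ⊗ f 0 ⊕ (g *ₚ divZ f) n      ≡⟨ ℚ√5.+-comm (g (suc n) ⊗ f 0) _ ⟩
    (g *ₚ divZ f) n ⊕ g (suc n) ⊗ f 0      ≡⟨ *ₚ-sucʳ g f n ⟨
    (g *ₚ f) (suc n)                       ∎
    where open ≡-Reasoning

  *ₚ-distribʳ : ∀ h f g → (f +ₚ g) *ₚ h ≈ₚ (f *ₚ h) +ₚ (g *ₚ h)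
  *ₚ-distribʳ h f g n = trans
    (sumTo-cong (suc n) (λ i _ → ℚ√5.distribʳ (h (n ∸ i)) (f i) (g i)))
    (sumTo-⊕ (suc n) (λ i → f i ⊗ h (n ∸ i)) (λ i → g i ⊗ h (n ∸ i)))

  *ₚ-scale : ∀ c f g → scale c f *ₚ g ≈ₚ scale c (f *ₚ g)
  *ₚ-scale c f g n = trans
    (sumTo-cong (suc n) (λ i _ → ℚ√5.*-assoc c (f i) (g (n ∸ i))))
    (sumTo-scale (suc n) c (λ i → f i ⊗ g (n ∸ i)))

  *ₚ-assoc : ∀ f g h → (f *ₚ g) *ₚ h ≈ₚ f *ₚ (g *ₚ h)
  *ₚ-assoc f g h zero = begin
    ((f *ₚ g) *ₚ h) 0     ≡⟨ *ₚ-zero (f *ₚ g) h ⟩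
    (f *ₚ g) 0 ⊗ h 0      ≡⟨ cong (_⊗ h 0) (*ₚ-zero f g) ⟩
    (f 0 ⊗ g 0) ⊗ h 0     ≡⟨ ℚ√5.*-assoc (f 0) (g 0) (h 0) ⟩
    f 0 ⊗ (g 0 ⊗ h 0)     ≡⟨ cong (f 0 ⊗_) (*ₚ-zero g h) ⟨
    f 0 ⊗ (g *ₚ h) 0      ≡⟨ *ₚ-zero f (g *ₚ h) ⟨
    (f *ₚ (g *ₚ h)) 0     ∎
    where open ≡-Reasoning
  *ₚ-assoc f g h (suc n) = begin
    ((f *ₚ g) *ₚ h) (suc n)
      ≡⟨ *ₚ-suc (f *ₚ g) h n ⟩
    (f *ₚ g) 0 ⊗ h (suc n) ⊕ (divZ (f *ₚ g) *ₚ h) n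
      -- By `*ₚ-suc`, `divZ (f *ₚ g)` is `scale (f 0) (divZ g) +ₚ (divZ f *ₚ g)`; only the second
      -- summand needs the induction hypothesis.
      ≡⟨ cong₂ _⊕_ (trans (cong (_⊗ h (suc n)) (*ₚ-zero f g)) (ℚ√5.*-assoc (f 0) (g 0) (h (suc n))))
                   (*ₚ-cong {g = h} (*ₚ-suc f g) (λ _ → refl) n) ⟩
    f 0 ⊗ (g 0 ⊗ h (suc n)) ⊕ ((scale (f 0) (divZ g) +ₚ (divZ f *ₚ g)) *ₚ h) n
      ≡⟨ cong (f 0 ⊗ (g 0 ⊗ h (suc n)) ⊕_) (*ₚ-distribʳ h (scale (f 0) (divZ g)) (divZ f *ₚ g) n) ⟩
    f 0 ⊗ (g 0 ⊗ h (suc n)) ⊕ ((scale (f 0) (divZ g) *ₚ h) n ⊕ ((divZ f *ₚ g) *ₚ h) n)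
      ≡⟨ cong (f 0 ⊗ (g 0 ⊗ h (suc n)) ⊕_) (cong₂ _⊕_ (*ₚ-scale (f 0) (divZ g) h n) (*ₚ-assoc (divZ f) g h n)) ⟩
    f 0 ⊗ (g 0 ⊗ h (suc n)) ⊕ (f 0 ⊗ (divZ g *ₚ h) n ⊕ (divZ f *ₚ (g *ₚ h)) n)
      ≡⟨ ℚ√5.+-assoc (f 0 ⊗ (g 0 ⊗ h (suc n))) _ _ ⟨
    f 0 ⊗ (g 0 ⊗ h (suc n)) ⊕ f 0 ⊗ (divZ g *ₚ h) n ⊕ (divZ f *ₚ (g *ₚ h)) n
      ≡⟨ cong (_⊕ (divZ f *ₚ (g *ₚ h)) n) (ℚ√5.distribˡ (f 0) (g 0 ⊗ h (suc n)) ((divZ g *ₚ h) n)) ⟨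
    f 0 ⊗ (g 0 ⊗ h (suc n) ⊕ (divZ g *ₚ h) n) ⊕ (divZ f *ₚ (g *ₚ h)) n
      ≡⟨ cong (λ x → f 0 ⊗ x ⊕ (divZ f *ₚ (g *ₚ h)) n) (*ₚ-suc g h n) ⟨
    f 0 ⊗ (g *ₚ h) (suc n) ⊕ (divZ f *ₚ (g *ₚ h)) n
      ≡⟨ *ₚ-suc f (g *ₚ h) n ⟨
    (f *ₚ (g *ₚ h)) (suc n) ∎
    where open ≡-Reasoning

  sumTo-zero : ∀ n f → (∀ i → f i ≡ 𝟘) → sumTo n f ≡ 𝟘
  sumTo-zero zero    f eq = refl
  sumTo-zero (suc n) f eq = trans (cong₂ _⊕_ (sumTo-zero n f eq) (eq n)) (ℚ√5.+-identityˡ 𝟘)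

  cst-* : ∀ c f → cst c *ₚ f ≈ₚ scale c f
  cst-* c f zero    = *ₚ-zero (cst c) f
  cst-* c f (suc n) = trans (*ₚ-suc (cst c) f n)
    (trans (cong (c ⊗ f (suc n) ⊕_) (sumTo-zero (suc n) _ (λ i → ℚ√5.zeroˡ (f (n ∸ i))))) (ℚ√5.+-identityʳ _))

  Z-*-suc : ∀ f n → (Z *ₚ f) (suc n) ≡ f n
  Z-*-suc f n = begin
    (Z *ₚ f) (suc n)                    ≡⟨ *ₚ-suc Z f n ⟩
    𝟘 ⊗ f (suc n) ⊕ (divZ Z *ₚ f) n     ≡⟨ cong₂ _⊕_ (ℚ√5.zeroˡ (f (suc n))) (*ₚ-cong {g = f} divZ-Z (λ _ → refl) n) ⟩
    𝟘 ⊕ (cst 𝟙 *ₚ f) n                  ≡⟨ ℚ√5.+-identityˡ _ ⟩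
    (cst 𝟙 *ₚ f) n                      ≡⟨ cst-* 𝟙 f n ⟩
    𝟙 ⊗ f n                             ≡⟨ ℚ√5.*-identityˡ (f n) ⟩
    f n                                 ∎
    where
    open ≡-Reasoning
    divZ-Z : divZ Z ≈ₚ cst 𝟙
    divZ-Z zero    = refl
    divZ-Z (suc n) = refl

  Z-*-zero : ∀ f → (Z *ₚ f) 0 ≡ 𝟘
  Z-*-zero f = trans (*ₚ-zero Z f) (ℚ√5.zeroˡ (f 0))

  cst-𝟘 : ∀ n → cst 𝟘 n ≡ 𝟘
  cst-𝟘 zero    = refl
  cst-𝟘 (suc n) = refl

  PS-isCommutativeRing : IsCommutativeRing _≈ₚ_ _+ₚ_ _*ₚ_ -ₚ_ (cst 𝟘) (cst 𝟙)
  PS-isCommutativeRing = record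
    { isRing = record
      { +-isAbelianGroup = record
        { isGroup = record
          { isMonoid = record
            { isSemigroup = record
              { isMagma = record
                { isEquivalence = record
                  { refl = λ _ → refl ; sym = λ p n → sym (p n) ; trans = λ p q n → trans (p n) (q n) }
                ; ∙-cong = λ p q n → cong₂ _⊕_ (p n) (q n)
                }
              ; assoc = λ f g h n → ℚ√5.+-assoc (f n) (g n) (h n)
              }
            ; identity = idˡ , λ f n → trans (ℚ√5.+-comm (f n) (cst 𝟘 n)) (idˡ f n)
            }
          ; inverse = invˡ , λ f n → trans (ℚ√5.+-comm (f n) (⊖ f n)) (invˡ f n)
          ; ⁻¹-cong = λ p n → cong ⊖_ (p n)
          }
        ; comm = λ f g n → ℚ√5.+-comm (f n) (g n)
        }
      ; *-cong = *ₚ-cong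
      ; *-assoc = *ₚ-assoc
      ; *-identity = *-idˡ , λ f n → trans (*ₚ-comm f (cst 𝟙) n) (*-idˡ f n)
      ; distrib = (λ h f g n → trans (*ₚ-comm h (f +ₚ g) n)
                    (trans (*ₚ-distribʳ h f g n) (cong₂ _⊕_ (*ₚ-comm f h n) (*ₚ-comm g h n))))
                , *ₚ-distribʳ
      }
    ; *-comm = *ₚ-comm
    }
    where
    idˡ : ∀ f → cst 𝟘 +ₚ f ≈ₚ f
    idˡ f n = trans (cong (_⊕ f n) (cst-𝟘 n)) (ℚ√5.+-identityˡ (f n))
    invˡ : ∀ f → (-ₚ f) +ₚ f ≈ₚ cst 𝟘
    invˡ f n = trans (ℚ√5.-‿inverseˡ (f n)) (sym (cst-𝟘 n))
    *-idˡ : ∀ f → cst 𝟙 *ₚ f ≈ₚ f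
    *-idˡ f n = trans (cst-* 𝟙 f n) (ℚ√5.*-identityˡ (f n))

  PS-commutativeRing : CommutativeRing 0ℓ 0ℓ
  PS-commutativeRing = record { isCommutativeRing = PS-isCommutativeRing }

-- Polynomial identities over an abstract commutative ring receiving `Q5`.

open import Algebra.Bundles using (CommutativeRing)
import Algebra.Solver.Ring as RingSolver
open import Algebra.Solver.Ring.AlmostCommutativeRing using (fromCommutativeRing; _-Raw-AlmostCommutative⟶_)
import Algebra.Properties.Ring as RingProperties
open import Data.Integer using (+_)
open import Data.Rational using (_/_)
open import Data.Nat.Base using (ℕ; zero; suc)
open import Relation.Nullary using (yes; no)

module RootAlgebra {c ℓ} (R : CommutativeRing c ℓ)
  (ι : CommutativeRing.rawRing PowerSeries.Q5-commutativeRing -Raw-AlmostCommutative⟶ fromCommutativeRing R) where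

  open import Data.Maybe.Base using (Maybe; just; nothing)
  import Relation.Binary.PropositionalEquality as ≡
  open CommutativeRing R
  open RingProperties ring using (x∙y⁻¹≈ε⇒x≈y)
  open import Relation.Binary.Reasoning.Setoid setoid
  open _-Raw-AlmostCommutative⟶_ ι using (⟦_⟧; 0-homo)

  coeff≟ : ∀ a b → Maybe (⟦ a ⟧ ≈ ⟦ b ⟧)
  coeff≟ a b with a PowerSeries.≟ b
  ... | yes ≡.refl = just refl
  ... | no  _      = nothing

  open RingSolver (CommutativeRing.rawRing PowerSeries.Q5-commutativeRing) (fromCommutativeRing R) ι coeff≟ hiding (⟦_⟧)

  -- Certificates of ideal membership: once cofactors of the known equations are supplied, the goal
  -- becomes one polynomial identity for the ring solver.
  combine₁ : ∀ {x y l r} q → l ≈ r → x - y ≈ q * (l - r) → x ≈ y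
  combine₁ {x} {y} {l} {r} q l≈r eq = x∙y⁻¹≈ε⇒x≈y x y (begin
    x - y        ≈⟨ eq ⟩
    q * (l - r)  ≈⟨ *-congˡ (trans (+-congʳ l≈r) (-‿inverseʳ r)) ⟩
    q * 0#       ≈⟨ zeroʳ q ⟩
    0#           ∎)

  combine₂ : ∀ {x y l r l′ r′} q q′ → l ≈ r → l′ ≈ r′ → x - y ≈ q * (l - r) + q′ * (l′ - r′) → x ≈ y
  combine₂ {x} {y} {l} {r} {l′} {r′} q q′ l≈r l′≈r′ eq = combine₁ q l≈r (begin
    x - y                            ≈⟨ eq ⟩
    q * (l - r) + q′ * (l′ - r′)     ≈⟨ +-congˡ (*-congˡ (trans (+-congʳ l′≈r′) (-‿inverseʳ r′))) ⟩
    q * (l - r) + q′ * 0#            ≈⟨ +-congˡ (zeroʳ q′) ⟩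
    q * (l - r) + 0#                 ≈⟨ +-identityʳ _ ⟩
    q * (l - r)                      ∎)

  combine₃ : ∀ {x y l r l′ r′ l″ r″} q q′ q″ → l ≈ r → l′ ≈ r′ → l″ ≈ r″ →
    x - y ≈ q * (l - r) + q′ * (l′ - r′) + q″ * (l″ - r″) → x ≈ y
  combine₃ {x} {y} {l} {r} {l′} {r′} {l″} {r″} q q′ q″ l≈r l′≈r′ l″≈r″ eq = combine₂ q q′ l≈r l′≈r′ (begin
    x - y                                                   ≈⟨ eq ⟩
    q * (l - r) + q′ * (l′ - r′) + q″ * (l″ - r″)           ≈⟨ +-congˡ (*-congˡ (trans (+-congʳ l″≈r″) (-‿inverseʳ r″))) ⟩
    q * (l - r) + q′ * (l′ - r′) + q″ * 0#                  ≈⟨ +-congˡ (zeroʳ q″) ⟩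
    q * (l - r) + q′ * (l′ - r′) + 0#                       ≈⟨ +-identityʳ _ ⟩
    q * (l - r) + q′ * (l′ - r′)                            ∎)

  one : Carrier
  one = ⟦ 𝟙 ⟧

  -- With `λ = 1/X` this reads `λ² − (1 + p t) λ + t = 0`. The product of these quadratics over the
  -- two roots of `p² = p + 1` is the characteristic polynomial of the transfer matrix.
  Root : (t p X : Carrier) → Set ℓ
  Root t p X = t * X * X + one ≈ (one + p * t) * X

  -- The kernel method: one linear relation from each root.

  module Kernel (t p X : Carrier) (root : Root t p X) (golden : p * p ≈ p + one)
    -- The order argument enters as a hypothesis; it holds for power series with `t` the variable.
    (vanish : (E : ℕ → Carrier) → (∀ v → E v ≈ (t * X) * E (suc v)) → ∀ v → E v ≈ 0#)
    (A B S T : ℕ → Carrier)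
    (S₀ : S 0 ≈ A 0) (T₀ : T 0 ≈ B 0)
    (A-rec : ∀ v → A v ≈ one + t * (A (suc v) + S v))
    (B-rec : ∀ v → B v ≈ t * (B (suc v) + A (suc v)))
    (S-rec : ∀ v → S (suc v) ≈ S v + A (suc v) + T v)
    (T-rec : ∀ v → T (suc v) ≈ T v + B (suc v)) where

    y : Carrier
    y = t * X

    -- The coefficient vector is a left eigenvector, with eigenvalue 1/X, of the map
    -- (A v , B v , S v , T v) ↦ t (A , B , S , T) (v + 1) given by the recurrences.
    form : (a b s t′ : Carrier) → Carrier
    form a b s t′ = (one - y) * (one - y) * a - p * y * (one - y) * b - (one - y) * t * s - y * t * t′ - (one - y)

    form-cong : ∀ {a a′ b b′ s s′ t t′} → a ≈ a′ → b ≈ b′ → s ≈ s′ → t ≈ t′ → form a b s t ≈ form a′ b′ s′ t′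
    form-cong a b s t = +-congʳ (+-cong (+-cong (+-cong (*-congˡ a) (-‿cong (*-congˡ b))) (-‿cong (*-congˡ s))) (-‿cong (*-congˡ t)))

    E : ℕ → Carrier
    E v = form (A v) (B v) (S v) (T v)

    E-step : ∀ v → E v ≈ y * E (suc v)
    E-step v = begin
      E v
        ≈⟨ form-cong (A-rec v) (B-rec v) refl refl ⟩
      form (one + t * (A (suc v) + S v)) (t * (B (suc v) + A (suc v))) (S v) (T v)
        -- The first two arguments are the cofactors of the quadratic for `X` and of `p² = p + 1`.
        ≈⟨ combine₂ ((one - y) * t * A (suc v) - p * y * t * B (suc v)) (- (t * y * y * B (suc v))) root golden (solve 7 (λ t p X a b s u →
             let 1' = con 𝟙
                 y = t :* X
                 form a b s u = (1' :- y) :* (1' :- y) :* a :- p :* y :* (1' :- y) :* b :- (1' :- y) :* t :* s :- y :* t :* u :- (1' :- y)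
             in form (1' :+ t :* (a :+ s)) (t :* (b :+ a)) s u :- y :* form a b (s :+ a :+ u) (u :+ b)
                := ((1' :- y) :* t :* a :- p :* y :* t :* b) :* (t :* X :* X :+ 1' :- (1' :+ p :* t) :* X)
                   :+ (:- (t :* y :* y :* b)) :* (p :* p :- (p :+ 1')))
             refl t p X (A (suc v)) (B (suc v)) (S v) (T v)) ⟩
      y * form (A (suc v)) (B (suc v)) (S v + A (suc v) + T v) (T v + B (suc v))
        ≈⟨ *-congˡ (form-cong refl refl (S-rec v) (T-rec v)) ⟨
      y * E (suc v) ∎

    -- E 0 = (1 − y) F, and the order argument also cancels the factor 1 − y.
    F : Carrier
    F = (one - y - t) * A 0 - (one + p * t * B 0)

    F-step : F ≈ y * F
    F-step = combine₃ one (- (p * t * B 0)) (- (t * y * B 0))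
      (trans (form-cong refl refl (sym S₀) (sym T₀)) (vanish E E-step 0)) root golden
      (trans (solve 5 (λ t p X a b →
        let 1' = con 𝟙
            y = t :* X
            f = (1' :- y :- t) :* a :- (1' :+ p :* t :* b)
        in f :- y :* f
           := 1' :* ((1' :- y) :* (1' :- y) :* a :- p :* y :* (1' :- y) :* b :- (1' :- y) :* t :* a :- y :* t :* b :- (1' :- y) :- con 𝟘)
              :+ (:- (p :* t :* b)) :* (t :* X :* X :+ 1' :- (1' :+ p :* t) :* X)
              :+ (:- (t :* y :* b)) :* (p :* p :- (p :+ 1'))) refl t p X (A 0) (B 0))
        (+-congʳ (+-congʳ (*-congˡ (+-congˡ (-‿cong 0-homo))))))

    initial-relation : (one - y - t) * A 0 ≈ one + p * t * B 0
    -- `F = y F` fits the order argument as a family constant in `v`.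
    initial-relation = x∙y⁻¹≈ε⇒x≈y _ _ (vanish (λ _ → F) (λ _ → F-step) 0)

  -- Eliminating `B` and solving for the generating function.

  module Elimination (t X₁ X₃ p i A B : Carrier)
    (root₁ : Root t p X₁) (root₃ : Root t (one - p) X₃)
    (eq₁ : (one - t * X₁ - t) * A ≈ one + p * t * B)
    (eq₃ : (one - t * X₃ - t) * A ≈ one + (one - p) * t * B)
    (inverse : i * (one - p - p) ≈ one) where

    den num : Carrier
    den = X₁ * X₃ * t * t - X₁ * t - X₃ * t - t + one
    num = X₁ * t + X₃ * t - one

    -- Multiplying `eq₁` by `1 − p`, `eq₃` by `p` and subtracting cancels `B`; `G` is the remaining
    -- coefficient of `A`.
    G : Carrier
    G = (one - p) * (one - t * X₁ - t) - p * (one - t * X₃ - t)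

    G*A : G * A ≈ one - p - p
    G*A = combine₂ (one - p) (- p) eq₁ eq₃ (solve 6 (λ t p x z a b →
      let 1' = con 𝟙 in
      ((1' :- p) :* (1' :- t :* x :- t) :- p :* (1' :- t :* z :- t)) :* a :- (1' :- p :- p)
      := (1' :- p) :* ((1' :- t :* x :- t) :* a :- (1' :+ p :* t :* b))
         :+ (:- p) :* ((1' :- t :* z :- t) :* a :- (1' :+ (1' :- p) :* t :* b))) refl t p X₁ X₃ A B)

    -- Brings in the stated denominator: combined with `G*A` and cancellation of `1 − 2p`, it gives
    -- `den * A = 1 − t X₁ X₃`.
    den-factor : (one - t * X₁ * X₃) * G ≈ (one - p - p) * den
    den-factor = combine₂ ((one - p) * t * X₃) (- (p * t * X₁)) root₁ root₃ (solve 4 (λ t p x z →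
      let 1' = con 𝟙 in
      (1' :- t :* x :* z) :* ((1' :- p) :* (1' :- t :* x :- t) :- p :* (1' :- t :* z :- t))
        :- (1' :- p :- p) :* (x :* z :* t :* t :- x :* t :- z :* t :- t :+ 1')
      := (1' :- p) :* t :* z :* (t :* x :* x :+ 1' :- (1' :+ p :* t) :* x)
         :+ (:- (p :* t :* x)) :* (t :* z :* z :+ 1' :- (1' :+ (1' :- p) :* t) :* z)) refl t p X₁ X₃)

    -- Since `den * A = 1 − t X₁ X₃`, the left side is `den + t (1 − t X₁ X₃)`, which is `- num`.
    -- The inverse `i` carries out the cancellation of `1 − 2p`.
    solution : (one + t * A) * den ≈ - num
    solution = combine₃ (- ((one + t * A) * den + num)) (- (i * t * A)) (i * t * (one - t * X₁ * X₃)) inverse den-factor G*A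
      (solve 7 (λ t p i x z a g →
        let 1' = con 𝟙
            den = x :* z :* t :* t :- x :* t :- z :* t :- t :+ 1'
            num = x :* t :+ z :* t :- 1'
        in (1' :+ t :* a) :* den :- (:- num)
           := (:- ((1' :+ t :* a) :* den :+ num)) :* (i :* (1' :- p :- p) :- 1')
              :+ (:- (i :* t :* a)) :* ((1' :- t :* x :* z) :* g :- (1' :- p :- p) :* den)
              :+ i :* t :* (1' :- t :* x :* z) :* (g :* a :- (1' :- p :- p))) refl t p i X₁ X₃ A G)

  -- The golden ratio, its conjugate, and the quadratics of `X₁` and `X₃`.

  ψ : Q5
  ψ = rat (+ 1 / 2) ⊗ (𝟙 ⊝ √5)

  -- For a series with constant term `1`, the quadratic forces the linear coefficient `1 − p`; hence
  -- `ψ = (1 − √5)/2` belongs to `X₁`, and its conjugate to `X₃`.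
  p₁ p₃ : Carrier
  p₁ = ⟦ ψ ⟧
  p₃ = one - p₁

  golden₁ : p₁ * p₁ ≈ p₁ + one
  golden₁ = solve 0 (con ψ :* con ψ := con ψ :+ con 𝟙) refl

  golden₃ : p₃ * p₃ ≈ p₃ + one
  golden₃ = solve 0 (let p₃ = con 𝟙 :- con ψ in p₃ :* p₃ := p₃ :+ con 𝟙) refl

  -- `1 − 2ψ` is `√5`, with inverse `√5/5`.
  ψ-inverse : ⟦ rat (+ 1 / 5) ⊗ √5 ⟧ * (one - p₁ - p₁) ≈ one
  ψ-inverse = solve 0 (con (rat (+ 1 / 5) ⊗ √5) :* (con 𝟙 :- con ψ :- con ψ) := con 𝟙) refl

  -- The quadratic formula read backwards: the radicands are B² − 16t.
  root₁ : ∀ t X S → (∀ f → t * f ≈ ⟦ 𝟘 ⟧ → f ≈ ⟦ 𝟘 ⟧) →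
    t * X ≈ ⟦ rat (+ 1 / 4) ⟧ * (⟦ nat 2 ⟧ + t * (⟦ 𝟙 ⊝ √5 ⟧ + t * ⟦ 𝟘 ⟧) - S) →
    S * S ≈ ⟦ nat 4 ⟧ + t * (⟦ ⊖ (nat 4 ⊗ (√5 ⊕ nat 3)) ⟧ + t * (⟦ ⊖ (nat 2 ⊗ (√5 ⊝ nat 3)) ⟧ + t * ⟦ 𝟘 ⟧)) →
    Root t p₁ X
  root₁ t X S cancel tX≈ S²≈ = x∙y⁻¹≈ε⇒x≈y _ _ (trans (cancel _
    -- `t` times the quadratic equals `(t X − B/4)² − D/16`; replacing `D` by `S²` makes it a
    -- difference of squares with a vanishing factor.
    (combine₂ (t * X - ⟦ rat (+ 1 / 4) ⟧ * (⟦ nat 2 ⟧ + t * (⟦ 𝟙 ⊝ √5 ⟧ + t * ⟦ 𝟘 ⟧) + S)) ⟦ rat (+ 1 / 16) ⟧ tX≈ S²≈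
      (solve 3 (λ t X S →
        let B = con (nat 2) :+ t :* (con (𝟙 ⊝ √5) :+ t :* con 𝟘)
            D = con (nat 4) :+ t :* (con (⊖ (nat 4 ⊗ (√5 ⊕ nat 3))) :+ t :* (con (⊖ (nat 2 ⊗ (√5 ⊝ nat 3))) :+ t :* con 𝟘))
        in t :* (t :* X :* X :+ con 𝟙 :- (con 𝟙 :+ con ψ :* t) :* X) :- con 𝟘
           := (t :* X :- con (rat (+ 1 / 4)) :* (B :+ S)) :* (t :* X :- con (rat (+ 1 / 4)) :* (B :- S))
              :+ con (rat (+ 1 / 16)) :* (S :* S :- D)) refl t X S))) 0-homo)

  root₃ : ∀ t X S → (∀ f → t * f ≈ ⟦ 𝟘 ⟧ → f ≈ ⟦ 𝟘 ⟧) →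
    t * X ≈ ⟦ rat (+ 1 / 4) ⟧ * (⟦ nat 2 ⟧ + t * (⟦ 𝟙 ⊕ √5 ⟧ + t * ⟦ 𝟘 ⟧) - S) →
    S * S ≈ ⟦ nat 4 ⟧ + t * (⟦ nat 4 ⊗ (√5 ⊝ nat 3) ⟧ + t * (⟦ nat 2 ⊗ (√5 ⊕ nat 3) ⟧ + t * ⟦ 𝟘 ⟧)) →
    Root t p₃ X
  root₃ t X S cancel tX≈ S²≈ = x∙y⁻¹≈ε⇒x≈y _ _ (trans (cancel _
    (combine₂ (t * X - ⟦ rat (+ 1 / 4) ⟧ * (⟦ nat 2 ⟧ + t * (⟦ 𝟙 ⊕ √5 ⟧ + t * ⟦ 𝟘 ⟧) + S)) ⟦ rat (+ 1 / 16) ⟧ tX≈ S²≈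
      (solve 3 (λ t X S →
        let B = con (nat 2) :+ t :* (con (𝟙 ⊕ √5) :+ t :* con 𝟘)
            D = con (nat 4) :+ t :* (con (nat 4 ⊗ (√5 ⊝ nat 3)) :+ t :* (con (nat 2 ⊗ (√5 ⊕ nat 3)) :+ t :* con 𝟘))
        in t :* (t :* X :* X :+ con 𝟙 :- (con 𝟙 :+ (con 𝟙 :- con ψ) :* t) :* X) :- con 𝟘
           := (t :* X :- con (rat (+ 1 / 4)) :* (B :+ S)) :* (t :* X :- con (rat (+ 1 / 4)) :* (B :- S))
              :+ con (rat (+ 1 / 16)) :* (S :* S :- D)) refl t X S))) 0-homo)

-- Inverses and square roots of power series.

import Algebra.Solver.Ring.Simple as SimpleSolver
open import Data.List using (List; []; _∷_; map; upTo; _++_; length)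
import Data.List.Properties as List
open import Data.Nat as ℕ using (_∸_; _≤_; _<_; s≤s⁻¹; z≤n)
import Data.Nat.Properties as ℕ
import Data.Integer as ℤ
import Data.Integer.Properties as ℤ
import Data.Rational as ℚ
import Data.Rational.Properties as ℚ
import Data.Rational.Unnormalised as ℚᵘ
import Data.Rational.Unnormalised.Properties as ℚᵘ
open import Data.Product using (_×_; _,_)
open import Relation.Binary.PropositionalEquality
open PowerSeries
open Counting using (A; B; S; T; I-suc; I-values)

module Q5-Solver = SimpleSolver (fromCommutativeRing Q5-commutativeRing) _≟_

-- `poly` has the same body as the private `nth`, so it serves to read the coefficient tables.
poly-++ˡ : ∀ xs ys {k} → k < length xs → poly (xs ++ ys) k ≡ poly xs k
poly-++ˡ (x ∷ xs) ys {zero}  _   = refl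
poly-++ˡ (x ∷ xs) ys {suc k} k<n = poly-++ˡ xs ys (s≤s⁻¹ k<n)

poly-last : ∀ xs x → poly (xs ++ x ∷ []) (length xs) ≡ x
poly-last []       x = refl
poly-last (y ∷ xs) x = poly-last xs x

-- The common shape of `invCoeffs` and `sqrtCoeffs`: each table extends the previous one by a single
-- coefficient, so earlier entries never change and the diagonal satisfies the defining recursion.
module Iterated (table : ℕ → List Q5) (new : ℕ → Q5)
  (start : length (table 0) ≡ 1) (grow : ∀ n → table (suc n) ≡ table n ++ new n ∷ []) where

  length-table : ∀ n → length (table n) ≡ suc n
  length-table zero    = start
  length-table (suc n) = begin
    length (table (suc n))          ≡⟨ cong length (grow n) ⟩
    length (table n ++ new n ∷ [])  ≡⟨ List.length-++ (table n) ⟩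
    length (table n) ℕ.+ 1          ≡⟨ ℕ.+-comm (length (table n)) 1 ⟩
    suc (length (table n))          ≡⟨ cong suc (length-table n) ⟩
    suc (suc n)                     ∎
    where open ≡-Reasoning

  newest : ∀ n → poly (table (suc n)) (suc n) ≡ new n
  newest n = trans (cong₂ poly (grow n) (sym (length-table n))) (poly-last (table n) (new n))

  stable : ∀ n {k} → k ≤ n → poly (table n) k ≡ poly (table k) k
  stable zero    z≤n = refl
  stable (suc n) {k} k≤1+n with k ℕ.≟ suc n
  ... | yes refl = refl
  ... | no  k≢   = begin
    poly (table (suc n)) k          ≡⟨ cong (λ xs → poly xs k) (grow n) ⟩
    poly (table n ++ new n ∷ []) k  ≡⟨ poly-++ˡ (table n) _ (subst (k <_) (sym (length-table n)) k<1+n) ⟩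
    poly (table n) k                ≡⟨ stable n (s≤s⁻¹ k<1+n) ⟩
    poly (table k) k                ∎
    where
    open ≡-Reasoning
    k<1+n : k < suc n
    k<1+n = ℕ.≤∧≢⇒< k≤1+n k≢

inv1-suc : ∀ f n → inv1 f (suc n) ≡ ⊖ sumTo (suc n) (λ i → f (suc i) ⊗ inv1 f (n ∸ i))
inv1-suc f n = trans (newest n) (cong ⊖_ (sumTo-cong (suc n) (λ i _ → cong (f (suc i) ⊗_) (stable n (ℕ.m∸n≤m n i)))))
  where open Iterated (invCoeffs f) _ refl (λ _ → refl)

*-inv1 : ∀ f → f 0 ≡ 𝟙 → f *ₚ inv1 f ≈ₚ cst 𝟙
*-inv1 f f₀≡1 zero    = trans (*ₚ-zero f (inv1 f)) (cong (_⊗ 𝟙) f₀≡1)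
*-inv1 f f₀≡1 (suc n) = begin
  (f *ₚ inv1 f) (suc n)                                     ≡⟨ *ₚ-suc f (inv1 f) n ⟩
  f 0 ⊗ inv1 f (suc n) ⊕ (divZ f *ₚ inv1 f) n               ≡⟨ cong₂ (λ a b → a ⊗ b ⊕ (divZ f *ₚ inv1 f) n) f₀≡1 (inv1-suc f n) ⟩
  𝟙 ⊗ (⊖ (divZ f *ₚ inv1 f) n) ⊕ (divZ f *ₚ inv1 f) n       ≡⟨ solve 1 (λ x → con 𝟙 :* (:- x) :+ x := con 𝟘) refl ((divZ f *ₚ inv1 f) n) ⟩
  𝟘                                                         ∎
  where
  open ≡-Reasoning
  open Q5-Solver

sqrt4-suc : ∀ D n → sqrt4 D (suc n) ≡
  (D (suc n) ⊝ sumTo n (λ i → sqrt4 D (suc i) ⊗ sqrt4 D (n ∸ i))) ⊗ rat (+ 1 / 4)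
sqrt4-suc D n = trans (newest n) (cong (λ x → (D (suc n) ⊝ x) ⊗ rat (+ 1 / 4))
  (sumTo-cong n (λ i i<n → cong₂ _⊗_ (stable n i<n) (stable n (ℕ.m∸n≤m n i)))))
  where open Iterated (sqrtCoeffs D) _ refl (λ _ → refl)

-- In degree `suc n` the two extreme terms of the convolution are each twice `R (suc n)` and the
-- inner ones sum to `σ`, whence the division by 4 in the recursion.
sqrt4-square : ∀ D → D 0 ≡ nat 4 → sqrt4 D *ₚ sqrt4 D ≈ₚ D
sqrt4-square D D₀≡4 zero    = sym D₀≡4
sqrt4-square D D₀≡4 (suc n) = begin
  (R *ₚ R) (suc n)                                 ≡⟨ *ₚ-suc R R n ⟩
  R 0 ⊗ R (suc n) ⊕ (σ ⊕ R (suc n) ⊗ R (n ∸ n))    ≡⟨ cong (λ k → R 0 ⊗ R (suc n) ⊕ (σ ⊕ R (suc n) ⊗ R k)) (ℕ.n∸n≡0 n) ⟩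
  nat 2 ⊗ R (suc n) ⊕ (σ ⊕ R (suc n) ⊗ nat 2)      ≡⟨ cong (λ x → nat 2 ⊗ x ⊕ (σ ⊕ x ⊗ nat 2)) (sqrt4-suc D n) ⟩
  nat 2 ⊗ ((D (suc n) ⊝ σ) ⊗ rat (+ 1 / 4)) ⊕ (σ ⊕ ((D (suc n) ⊝ σ) ⊗ rat (+ 1 / 4)) ⊗ nat 2)
    ≡⟨ solve 2 (λ d s → let x = (d :- s) :* con (rat (+ 1 / 4)) in
                        con (nat 2) :* x :+ (s :+ x :* con (nat 2)) := d) refl (D (suc n)) σ ⟩
  D (suc n)                                        ∎
  where
  open ≡-Reasoning
  open Q5-Solver
  R = sqrt4 D
  σ = sumTo n (λ i → R (suc i) ⊗ R (n ∸ i))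

-- Specialisation to power series, with `t` the variable `Z`.

cst-morphism : CommutativeRing.rawRing Q5-commutativeRing -Raw-AlmostCommutative⟶ fromCommutativeRing PS-commutativeRing
cst-morphism = record
  { ⟦_⟧    = cst
  ; +-homo = λ { a b zero → refl ; a b (suc n) → refl }
  ; *-homo = λ { a b zero → sym (*ₚ-zero (cst a) (cst b))
               ; a b (suc n) → sym (trans (cst-* a (cst b) (suc n)) (ℚ√5.zeroʳ a)) }
  ; -‿homo = λ { a zero → refl ; a (suc n) → refl }
  ; 0-homo = λ _ → refl
  ; 1-homo = λ _ → refl
  }

open RootAlgebra PS-commutativeRing cst-morphism
module Series = CommutativeRing PS-commutativeRing

poly-∷ : ∀ c cs {f} → poly cs ≈ₚ f → poly (c ∷ cs) ≈ₚ cst c +ₚ Z *ₚ f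
poly-∷ c cs {f} eq zero    = sym (trans (cong (c ⊕_) (Z-*-zero f)) (ℚ√5.+-identityʳ c))
poly-∷ c cs {f} eq (suc n) = trans (eq n) (sym (trans (cong (𝟘 ⊕_) (Z-*-suc f n)) (ℚ√5.+-identityˡ (f n))))

poly-[] : poly [] ≈ₚ cst 𝟘
poly-[] zero    = refl
poly-[] (suc n) = refl

poly-linear : ∀ a b → poly (a ∷ b ∷ []) ≈ₚ cst a +ₚ Z *ₚ (cst b +ₚ Z *ₚ cst 𝟘)
poly-linear a b = poly-∷ a (b ∷ []) (poly-∷ b [] poly-[])

poly-quadratic : ∀ a b c → poly (a ∷ b ∷ c ∷ []) ≈ₚ cst a +ₚ Z *ₚ (cst b +ₚ Z *ₚ (cst c +ₚ Z *ₚ cst 𝟘))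
poly-quadratic a b c = poly-∷ a (b ∷ c ∷ []) (poly-linear b c)

Z-cancel : ∀ f → Z *ₚ f ≈ₚ cst 𝟘 → f ≈ₚ cst 𝟘
Z-cancel f Zf≈0 n = trans (sym (Z-*-suc f n)) (trans (Zf≈0 (suc n)) (sym (cst-𝟘 n)))

Z-divZ : ∀ f → f 0 ≡ 𝟘 → Z *ₚ divZ f ≈ₚ f
Z-divZ f f₀≡0 zero    = trans (Z-*-zero (divZ f)) (sym f₀≡0)
Z-divZ f f₀≡0 (suc n) = Z-*-suc (divZ f) n

Z-scale-divZ : ∀ c f → f 0 ≡ 𝟘 → Z *ₚ scale c (divZ f) ≈ₚ cst c *ₚ f
Z-scale-divZ c f f₀≡0 = Series.trans
  (Z-divZ (scale c f) (trans (cong (c ⊗_) f₀≡0) (ℚ√5.zeroʳ c)))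
  (Series.sym (cst-* c f))

Z*numerator : ∀ a b R → (poly (a ∷ b ∷ []) -ₚ R) 0 ≡ 𝟘 →
  Z *ₚ scale (rat (+ 1 / 4)) (divZ (poly (a ∷ b ∷ []) -ₚ R)) ≈ₚ
  cst (rat (+ 1 / 4)) *ₚ (cst a +ₚ Z *ₚ (cst b +ₚ Z *ₚ cst 𝟘) -ₚ R)
Z*numerator a b R eq = Series.trans (Z-scale-divZ (rat (+ 1 / 4)) (poly (a ∷ b ∷ []) -ₚ R) eq)
  (Series.*-congˡ {cst (rat (+ 1 / 4))} (λ n → cong (_⊕ (⊖ R n)) (poly-linear a b n)))

X₁-root : Root Z p₁ X₁
X₁-root = root₁ Z X₁ (sqrt4 D₁) Z-cancel
  (Z*numerator (nat 2) (𝟙 ⊝ √5) (sqrt4 D₁) refl)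
  (Series.trans (sqrt4-square D₁ refl)
    (poly-quadratic (nat 4) (⊖ (nat 4 ⊗ (√5 ⊕ nat 3))) (⊖ (nat 2 ⊗ (√5 ⊝ nat 3)))))

X₃-root : Root Z p₃ X₃
X₃-root = root₃ Z X₃ (sqrt4 D₃) Z-cancel
  (Z*numerator (nat 2) (𝟙 ⊕ √5) (sqrt4 D₃) refl)
  (Series.trans (sqrt4-square D₃ refl)
    (poly-quadratic (nat 4) (nat 4 ⊗ (√5 ⊝ nat 3)) (nat 2 ⊗ (√5 ⊕ nat 3))))

-- Each step of E v ≈ Z X E (v + 1) raises the order by one.
vanish : ∀ X (E : ℕ → PS) → (∀ v → E v ≈ₚ (Z *ₚ X) *ₚ E (suc v)) → ∀ v → E v ≈ₚ cst 𝟘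
vanish X E step v n = trans (below (suc n) v n ℕ.≤-refl) (sym (cst-𝟘 n))
  where
  shifted : ∀ v → E v ≈ₚ Z *ₚ (X *ₚ E (suc v))
  shifted v = Series.trans (step v) (*ₚ-assoc Z X (E (suc v)))
  -- Induction on a bound for the degree, with `v` free: the coefficient of degree `suc m` of `E v`
  -- involves only coefficients of `E (suc v)` of degree at most `m`.
  below : ∀ N v m → m < N → E v m ≡ 𝟘
  below (suc N) v zero    _   = trans (shifted v 0) (Z-*-zero (X *ₚ E (suc v)))
  below (suc N) v (suc m) m<N = trans (shifted v (suc m)) (trans (Z-*-suc (X *ₚ E (suc v)) m)
    (sumTo-zero (suc m) _ (λ i → trans
      (cong (X i ⊗_) (below N (suc v) (m ∸ i) (ℕ.≤-<-trans (ℕ.m∸n≤m m i) (s≤s⁻¹ m<N))))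
      (ℚ√5.zeroʳ (X i)))))

-- Generating functions of the counts and their recurrences.

nat-+ : ∀ m n → nat (m ℕ.+ n) ≡ nat m ⊕ nat n
nat-+ m n = cong rat (ℚ.toℚᵘ-injective (begin
  ℚ.toℚᵘ (+ (m ℕ.+ n) / 1)              ≈⟨ ℚ.toℚᵘ-fromℚᵘ (ℚᵘ.mkℚᵘ (+ (m ℕ.+ n)) 0) ⟩
  ℚᵘ.mkℚᵘ (+ (m ℕ.+ n)) 0               ≈⟨ ℚᵘ.*≡* (cong₂ ℤ._*_ (sym (cong₂ ℤ._+_ (ℤ.*-identityʳ (+ m)) (ℤ.*-identityʳ (+ n)))) refl) ⟩
  ℚᵘ.mkℚᵘ (+ m) 0 ℚᵘ.+ ℚᵘ.mkℚᵘ (+ n) 0  ≈⟨ ℚᵘ.+-cong (ℚ.toℚᵘ-fromℚᵘ (ℚᵘ.mkℚᵘ (+ m) 0)) (ℚ.toℚᵘ-fromℚᵘ (ℚᵘ.mkℚᵘ (+ n) 0)) ⟨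
  ℚ.toℚᵘ (+ m / 1) ℚᵘ.+ ℚ.toℚᵘ (+ n / 1) ≈⟨ ℚ.toℚᵘ-homo-+ (+ m / 1) (+ n / 1) ⟨
  ℚ.toℚᵘ (+ m / 1 ℚ.+ + n / 1)          ∎))
  where
  open import Relation.Binary.Reasoning.Setoid ℚᵘ.≃-setoid

ogf : (ℕ → ℕ → ℕ) → ℕ → PS
ogf f v k = nat (f k v)

A-rec : ∀ v → ogf A v ≈ₚ cst 𝟙 +ₚ Z *ₚ (ogf A (suc v) +ₚ ogf S v)
A-rec v zero    = sym (cong (𝟙 ⊕_) (Z-*-zero (ogf A (suc v) +ₚ ogf S v)))
A-rec v (suc k) = begin
  nat (A k (suc v) ℕ.+ S k v)                            ≡⟨ nat-+ (A k (suc v)) (S k v) ⟩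
  (ogf A (suc v) +ₚ ogf S v) k                           ≡⟨ Z-*-suc (ogf A (suc v) +ₚ ogf S v) k ⟨
  (Z *ₚ (ogf A (suc v) +ₚ ogf S v)) (suc k)              ≡⟨ ℚ√5.+-identityˡ _ ⟨
  𝟘 ⊕ (Z *ₚ (ogf A (suc v) +ₚ ogf S v)) (suc k)          ∎
  where open ≡-Reasoning

B-rec : ∀ v → ogf B v ≈ₚ Z *ₚ (ogf B (suc v) +ₚ ogf A (suc v))
B-rec v zero    = sym (Z-*-zero (ogf B (suc v) +ₚ ogf A (suc v)))
B-rec v (suc k) = trans (nat-+ (B k (suc v)) (A k (suc v))) (sym (Z-*-suc (ogf B (suc v) +ₚ ogf A (suc v)) k))

S-rec : ∀ v → ogf S (suc v) ≈ₚ ogf S v +ₚ ogf A (suc v) +ₚ ogf T v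
S-rec v k = trans (nat-+ (S k v ℕ.+ A k (suc v)) (T k v)) (cong (_⊕ nat (T k v)) (nat-+ (S k v) (A k (suc v))))

T-rec : ∀ v → ogf T (suc v) ≈ₚ ogf T v +ₚ ogf B (suc v)
T-rec v k = nat-+ (T k v) (B k (suc v))

relation : ∀ p X → Root Z p X → p *ₚ p ≈ₚ p +ₚ cst 𝟙 →
  (cst 𝟙 -ₚ Z *ₚ X -ₚ Z) *ₚ ogf A 0 ≈ₚ cst 𝟙 +ₚ p *ₚ Z *ₚ ogf B 0
relation p X root golden = Kernel.initial-relation Z p X root golden (vanish X)
  (ogf A) (ogf B) (ogf S) (ogf T) (λ _ → refl) (λ _ → refl) A-rec B-rec S-rec T-rec

-- The closed form.

GF-split : GF ≈ₚ cst 𝟙 +ₚ Z *ₚ ogf A 0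
GF-split zero    = sym (cong (𝟙 ⊕_) (Z-*-zero (ogf A 0)))
GF-split (suc k) = trans (cong nat (I-suc k)) (sym (trans (ℚ√5.+-identityˡ _) (Z-*-suc (ogf A 0) k)))

GF*Den : GF *ₚ Den ≈ₚ -ₚ Num
GF*Den = Series.trans (*ₚ-cong {g = Den} GF-split (λ _ → refl))
  (Elimination.solution Z X₁ X₃ p₁ (cst (rat (+ 1 / 5) ⊗ √5)) (ogf A 0) (ogf B 0) X₁-root X₃-root
    (relation p₁ X₁ X₁-root golden₁) (relation p₃ X₃ X₃-root golden₃) ψ-inverse)

GF-closed : GF ≈ₚ (-ₚ Num) *ₚ inv1 Den
GF-closed = begin
  GF                        ≈⟨ Series.*-identityʳ GF ⟨
  GF *ₚ cst 𝟙               ≈⟨ Series.*-congˡ {GF} (*-inv1 Den refl) ⟨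
  GF *ₚ (Den *ₚ inv1 Den)   ≈⟨ *ₚ-assoc GF Den (inv1 Den) ⟨
  (GF *ₚ Den) *ₚ inv1 Den   ≈⟨ *ₚ-cong {g = inv1 Den} GF*Den (λ _ → refl) ⟩
  (-ₚ Num) *ₚ inv1 Den      ∎
  where open import Relation.Binary.Reasoning.Setoid Series.setoid

mainTheorem7 :
  -- well-definedness: radicands have constant term 4, numerators vanish at z = 0,
  -- the denominator has constant term 1 (so it is invertible)
  (D₁ 0 ≡ nat 4) × (D₃ 0 ≡ nat 4)
  × ((B₁ -ₚ sqrt4 D₁) 0 ≡ 𝟘) × ((B₃ -ₚ sqrt4 D₃) 0 ≡ 𝟘)
  × (Den 0 ≡ 𝟙)
  -- stated expansions of X₁ and X₃
  × (map X₁ (upTo 3) ≡ 𝟙 ∷ rat (+ 1 / 2) ⊗ (𝟙 ⊕ √5) ∷ (nat 2 ⊕ √5) ∷ [])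
  × (map X₃ (upTo 3) ≡ 𝟙 ∷ rat (+ 1 / 2) ⊗ (𝟙 ⊝ √5) ∷ (nat 2 ⊝ √5) ∷ [])
  -- the generating function identity  Σ I_n zⁿ = -(X₁z + X₃z - 1) / Den
  × ((n : ℕ) → GF n ≡ ((-ₚ Num) *ₚ inv1 Den) n)
  -- the stated initial terms
  × (map I (upTo 8) ≡ 1 ∷ 1 ∷ 2 ∷ 5 ∷ 15 ∷ 51 ∷ 188 ∷ 733 ∷ [])
mainTheorem7 = refl , refl , refl , refl , refl , refl , refl , GF-closed , I-values
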